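{- Let $M$ be a connected finite simple graph on $p$ vertices and let $\Delta$ be the maximum vertex degree of $M$. Then $$E(M) \leq \frac{p}{2}\,PE(M) \leq \frac{p^2(p-1)\Delta}{2},$$ where $E(M)$ is the energy and $PE(M)$ the path energy of $M$. Moreover, equality holds (in both inequalities) if $M=K_2$.
   Context: The energy $E(M)$ of a finite simple graph $M$ is the sum of the absolute values of the eigenvalues (with multiplicity) of its adjacency matrix. For a finite simple graph $M$ with vertex set $\{v_1,\dots,v_p\}$, the path matrix $P(M)=(p_{i,j})$ is the $p\times p$ real symmetric matrix with $p_{i,i}=0$ and, for $i\neq j$, $p_{i,j}$ equal to the maximum number of vertex disjoint paths from $v_i$ to $v_j$ (i.e. paths that pairwise share no vertices other than the endpoints $v_i,v_j$; an edge $v_iv_j$ counts as one such path). The path eigenvalues of $M$ are the eigenvalues of $P(M)$, and the path energy $PE(M)$ is the sum of the absolute values of the path eigenvalues, counted with multiplicity. $K_2$ is the complete graph on two vertices. -}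

module Defs where

open import Algebra.Bundles.Raw using (RawRing)
import Algebra.Definitions.RawMonoid as RawMonoidDefs
import Algebra.Definitions.RawSemiring as RawSemiringDefs
open import Data.Bool.Base using (if_then_else_)
open import Data.Fin.Base using (Fin; zero; suc; toℕ)
import Data.Fin.Properties as Fin
open import Data.Integer.Base using (+_)
open import Data.List.Base as List
  using (List; []; _∷_; _++_; _∷ʳ_; length; filter; allFin; upTo; concatMap; cartesianProductWith)
open import Data.List.Extrema.Nat using (max)
open import Data.List.Membership.Propositional using (_∈_; find; lose)
open import Data.List.Membership.Propositional.Properties
  using (∈-∃++; ∈-++⁻; ∈-++⁺ˡ; ∈-++⁺ʳ; ∈-filter⁺; ∈-filter⁻; ∈-allFin; ∈-upTo⁺;
         ∈-concatMap⁺; ∈-cartesianProductWith⁺; ∈-cartesianProductWith⁻)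
open import Data.List.Properties using (length-++; length-tabulate; ≡-dec)
open import Data.List.Relation.Binary.Disjoint.Propositional using (Disjoint)
import Data.List.Relation.Binary.Disjoint.DecPropositional as DisjointDec
open import Data.List.Relation.Binary.Subset.Propositional using (_⊆_)
open import Data.List.Relation.Unary.All as All using (All; []; _∷_; all?)
open import Data.List.Relation.Unary.All.Properties using (++⁻ˡ)
open import Data.List.Relation.Unary.AllPairs as AllPairs using (AllPairs; []; _∷_; allPairs?)
open import Data.List.Relation.Unary.Any using (here; there; any?)
open import Data.List.Relation.Unary.Linked using (Linked; linked?)
open import Data.List.Relation.Unary.Unique.Propositional using (Unique)
import Data.List.Relation.Unary.Unique.DecPropositional as UniqueDec
open import Data.Nat.Base as ℕ using (ℕ; zero; suc; z≤n; s≤s)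
import Data.Nat.Properties as ℕ
open import Data.Product.Base using (∃; _×_; _,_; proj₁; proj₂)
open import Data.Rational.Base as ℚ using (ℚ; 0ℚ; 1ℚ; ½; _<_; _≤_; ∣_∣)
import Data.Rational.Properties as ℚ
open import Data.Rational.Solver using (module +-*-Solver)
open import Data.Sum.Base using (inj₁; inj₂)
open import Data.Vec.Functional as Vector using (Vector)
open import Function.Base using (_∘_)
open import Function.Bundles using (_↔_; _⇔_; Inverse)
open import Level using (0ℓ)
open import Relation.Binary.Construct.Closure.ReflexiveTransitive using (Star)
open import Relation.Binary.Core using (Rel)
open import Relation.Binary.Definitions using (Decidable; Symmetric; Irreflexive)
open import Relation.Binary.PropositionalEquality
open import Relation.Nullary.Decidable using (Dec; yes; no; does; map′; ¬?; _×-dec_; ⌊_⌋)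
open import Relation.Nullary.Negation using (¬_; contradiction)
import Relation.Unary as Unary

open +-*-Solver using (solve; _:+_; _:-_; _:*_; :-_; _:=_)

------------------------------------------------------------------------
-- Real numbers: Cauchy sequences of rationals, compared by _≃ℝ_

record ℝ : Set where
  constructor mkℝ
  field
    seq    : ℕ → ℚ
    cauchy : ∀ ε → 0ℚ < ε →
             ∃ λ N → ∀ m n → N ℕ.≤ m → N ℕ.≤ n → ∣ seq m ℚ.- seq n ∣ < ε

open ℝ public

infix  4 _≃ℝ_ _≤ℝ_
infixl 6 _+ℝ_ _-ℝ_
infixl 7 _*ℝ_
infix  8 -ℝ_

_≃ℝ_ : ℝ → ℝ → Set
x ≃ℝ y = ∀ ε → 0ℚ < ε → ∃ λ N → ∀ n → N ℕ.≤ n → ∣ seq x n ℚ.- seq y n ∣ < ε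

_≤ℝ_ : ℝ → ℝ → Set
x ≤ℝ y = ∀ ε → 0ℚ < ε → ∃ λ N → ∀ n → N ℕ.≤ n → seq x n < seq y n ℚ.+ ε

private
  0<½ : 0ℚ < ½
  0<½ = ℚ.positive⁻¹ ½

  0<½ε : ∀ {ε} → 0ℚ < ε → 0ℚ < ½ ℚ.* ε
  0<½ε {ε} 0<ε = subst (_< ½ ℚ.* ε) (ℚ.*-zeroʳ ½) (ℚ.*-monoʳ-<-pos ½ 0<ε)

  ½ε+½ε : ∀ ε → ½ ℚ.* ε ℚ.+ ½ ℚ.* ε ≡ ε
  ½ε+½ε ε = trans (sym (ℚ.*-distribʳ-+ ε ½ ½)) (ℚ.*-identityˡ ε)

  pos-* : ∀ {p q} → 0ℚ < p → 0ℚ < q → 0ℚ < p ℚ.* q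
  pos-* {p} {q} 0<p 0<q =
    subst (_< p ℚ.* q) (ℚ.*-zeroʳ p) (ℚ.*-monoʳ-<-pos p {{ℚ.positive 0<p}} 0<q)

  bounded : (x : ℝ) → ∃ λ N → ∃ λ B → 0ℚ < B × (∀ n → N ℕ.≤ n → ∣ seq x n ∣ ≤ B)
  bounded x with cauchy x 1ℚ (ℚ.positive⁻¹ 1ℚ)
  ... | N , c = N , 1ℚ ℚ.+ ∣ seq x N ∣ , 0<B , bound
    where
    0<B : 0ℚ < 1ℚ ℚ.+ ∣ seq x N ∣
    0<B = ℚ.+-mono-<-≤ (ℚ.positive⁻¹ 1ℚ) (ℚ.0≤∣p∣ (seq x N))

    split : ∀ a b → (a ℚ.- b) ℚ.+ b ≡ a
    split = solve 2 (λ a b → (a :- b) :+ b := a) refl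

    open ℚ.≤-Reasoning
    bound : ∀ n → N ℕ.≤ n → ∣ seq x n ∣ ≤ 1ℚ ℚ.+ ∣ seq x N ∣
    bound n N≤n = begin
      ∣ seq x n ∣                              ≡⟨ cong ∣_∣ (split (seq x n) (seq x N)) ⟨
      ∣ (seq x n ℚ.- seq x N) ℚ.+ seq x N ∣    ≤⟨ ℚ.∣p+q∣≤∣p∣+∣q∣ (seq x n ℚ.- seq x N) (seq x N) ⟩
      ∣ seq x n ℚ.- seq x N ∣ ℚ.+ ∣ seq x N ∣  ≤⟨ ℚ.+-monoˡ-≤ ∣ seq x N ∣ (ℚ.<⇒≤ (c n N N≤n ℕ.≤-refl)) ⟩
      1ℚ ℚ.+ ∣ seq x N ∣                       ∎

fromℚ : ℚ → ℝ
fromℚ q = mkℝ (λ _ → q)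
  λ ε 0<ε → 0 , λ _ _ _ _ → subst (_< ε) (sym (cong ∣_∣ (ℚ.+-inverseʳ q))) 0<ε

0ℝ 1ℝ : ℝ
0ℝ = fromℚ 0ℚ
1ℝ = fromℚ 1ℚ

_+ℝ_ : ℝ → ℝ → ℝ
x +ℝ y = mkℝ (λ n → seq x n ℚ.+ seq y n) c
  where
  regroup : ∀ a b c d → (a ℚ.+ b) ℚ.- (c ℚ.+ d) ≡ (a ℚ.- c) ℚ.+ (b ℚ.- d)
  regroup = solve 4 (λ a b c d → (a :+ b) :- (c :+ d) := (a :- c) :+ (b :- d)) refl

  open ℚ.≤-Reasoning
  c : ∀ ε → 0ℚ < ε → ∃ λ N → ∀ m n → N ℕ.≤ m → N ℕ.≤ n →
      ∣ (seq x m ℚ.+ seq y m) ℚ.- (seq x n ℚ.+ seq y n) ∣ < ε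
  c ε 0<ε with cauchy x (½ ℚ.* ε) (0<½ε 0<ε) | cauchy y (½ ℚ.* ε) (0<½ε 0<ε)
  ... | N₁ , c₁ | N₂ , c₂ = N₁ ℕ.⊔ N₂ , λ m n N≤m N≤n → begin-strict
    ∣ (seq x m ℚ.+ seq y m) ℚ.- (seq x n ℚ.+ seq y n) ∣
      ≡⟨ cong ∣_∣ (regroup (seq x m) (seq y m) (seq x n) (seq y n)) ⟩
    ∣ (seq x m ℚ.- seq x n) ℚ.+ (seq y m ℚ.- seq y n) ∣
      ≤⟨ ℚ.∣p+q∣≤∣p∣+∣q∣ (seq x m ℚ.- seq x n) (seq y m ℚ.- seq y n) ⟩
    ∣ seq x m ℚ.- seq x n ∣ ℚ.+ ∣ seq y m ℚ.- seq y n ∣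
      <⟨ ℚ.+-mono-< (c₁ m n (ℕ.m⊔n≤o⇒m≤o N₁ N₂ N≤m) (ℕ.m⊔n≤o⇒m≤o N₁ N₂ N≤n))
                    (c₂ m n (ℕ.m⊔n≤o⇒n≤o N₁ N₂ N≤m) (ℕ.m⊔n≤o⇒n≤o N₁ N₂ N≤n)) ⟩
    ½ ℚ.* ε ℚ.+ ½ ℚ.* ε
      ≡⟨ ½ε+½ε ε ⟩
    ε ∎

-ℝ_ : ℝ → ℝ
-ℝ x = mkℝ (λ n → ℚ.- seq x n) c
  where
  regroup : ∀ a b → (ℚ.- a) ℚ.- (ℚ.- b) ≡ ℚ.- (a ℚ.- b)
  regroup = solve 2 (λ a b → (:- a) :- (:- b) := :- (a :- b)) refl

  c : ∀ ε → 0ℚ < ε → ∃ λ N → ∀ m n → N ℕ.≤ m → N ℕ.≤ n →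
      ∣ (ℚ.- seq x m) ℚ.- (ℚ.- seq x n) ∣ < ε
  c ε 0<ε with cauchy x ε 0<ε
  ... | N , c₁ = N , λ m n N≤m N≤n →
    subst (_< ε)
      (sym (trans (cong ∣_∣ (regroup (seq x m) (seq x n))) (ℚ.∣-p∣≡∣p∣ (seq x m ℚ.- seq x n))))
      (c₁ m n N≤m N≤n)

_-ℝ_ : ℝ → ℝ → ℝ
x -ℝ y = x +ℝ (-ℝ y)

private
  *-estimate : ∀ a b c d A B η → 0ℚ < A → 0ℚ < B → ∣ a ∣ ≤ A → ∣ d ∣ ≤ B →
               ∣ b ℚ.- d ∣ < η → ∣ a ℚ.- c ∣ < η →
               ∣ a ℚ.* b ℚ.- c ℚ.* d ∣ < (A ℚ.+ B) ℚ.* η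
  *-estimate a b c d A B η 0<A 0<B a≤A d≤B b-d<η a-c<η = begin-strict
    ∣ a ℚ.* b ℚ.- c ℚ.* d ∣
      ≡⟨ cong ∣_∣ (regroup a b c d) ⟩
    ∣ a ℚ.* (b ℚ.- d) ℚ.+ d ℚ.* (a ℚ.- c) ∣
      ≤⟨ ℚ.∣p+q∣≤∣p∣+∣q∣ (a ℚ.* (b ℚ.- d)) (d ℚ.* (a ℚ.- c)) ⟩
    ∣ a ℚ.* (b ℚ.- d) ∣ ℚ.+ ∣ d ℚ.* (a ℚ.- c) ∣
      <⟨ ℚ.+-mono-< {∣ a ℚ.* (b ℚ.- d) ∣} {A ℚ.* η} {∣ d ℚ.* (a ℚ.- c) ∣} {B ℚ.* η}
           (term a (b ℚ.- d) A 0<A a≤A b-d<η) (term d (a ℚ.- c) B 0<B d≤B a-c<η) ⟩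
    A ℚ.* η ℚ.+ B ℚ.* η
      ≡⟨ ℚ.*-distribʳ-+ η A B ⟨
    (A ℚ.+ B) ℚ.* η ∎
    where
    open ℚ.≤-Reasoning

    regroup : ∀ a b c d → a ℚ.* b ℚ.- c ℚ.* d ≡ a ℚ.* (b ℚ.- d) ℚ.+ d ℚ.* (a ℚ.- c)
    regroup = solve 4 (λ a b c d → a :* b :- c :* d := a :* (b :- d) :+ d :* (a :- c)) refl

    term : ∀ p q P → 0ℚ < P → ∣ p ∣ ≤ P → ∣ q ∣ < η → ∣ p ℚ.* q ∣ < P ℚ.* η
    term p q P 0<P p≤P q<η = begin-strict
      ∣ p ℚ.* q ∣      ≡⟨ ℚ.∣p*q∣≡∣p∣*∣q∣ p q ⟩
      ∣ p ∣ ℚ.* ∣ q ∣  ≤⟨ ℚ.*-monoʳ-≤-nonNeg ∣ q ∣ {{ℚ.∣-∣-nonNeg q}} p≤P ⟩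
      P ℚ.* ∣ q ∣      <⟨ ℚ.*-monoʳ-<-pos P {{ℚ.positive 0<P}} q<η ⟩
      P ℚ.* η          ∎

  -- For K > 0 every ε > 0 has the form K * η with η > 0.
  split-off : ∀ K ε → 0ℚ < K → 0ℚ < ε → ∃ λ η → 0ℚ < η × K ℚ.* η ≡ ε
  split-off K ε 0<K 0<ε =
    ℚ.1/ K ℚ.* ε , pos-* (ℚ.positive⁻¹ (ℚ.1/ K) {{ℚ.1/pos⇒pos K}}) 0<ε ,
    trans (sym (ℚ.*-assoc K (ℚ.1/ K) ε))
      (trans (cong (ℚ._* ε) (ℚ.*-inverseʳ K)) (ℚ.*-identityˡ ε))
    where
    instance
      K-pos : ℚ.Positive K
      K-pos = ℚ.positive 0<K

      K-nonZero : ℚ.NonZero K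
      K-nonZero = ℚ.pos⇒nonZero K

_*ℝ_ : ℝ → ℝ → ℝ
x *ℝ y = mkℝ (λ n → seq x n ℚ.* seq y n) c
  where
  c : ∀ ε → 0ℚ < ε → ∃ λ N → ∀ m n → N ℕ.≤ m → N ℕ.≤ n →
      ∣ seq x m ℚ.* seq y m ℚ.- seq x n ℚ.* seq y n ∣ < ε
  c ε 0<ε =
    let N₁ , A , 0<A , x≤A = bounded x
        N₂ , B , 0<B , y≤B = bounded y
        η , 0<η , Kη≡ε     = split-off (A ℚ.+ B) ε (ℚ.+-mono-< {0ℚ} {A} {0ℚ} {B} 0<A 0<B) 0<ε
        N₃ , c₁            = cauchy x η 0<η
        N₄ , c₂            = cauchy y η 0<η
        L                  = N₁ ℕ.⊔ N₂
        R                  = N₃ ℕ.⊔ N₄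
    in L ℕ.⊔ R , λ m n N≤m N≤n →
      let L≤m = ℕ.m⊔n≤o⇒m≤o L R N≤m
          R≤m = ℕ.m⊔n≤o⇒n≤o L R N≤m
          L≤n = ℕ.m⊔n≤o⇒m≤o L R N≤n
          R≤n = ℕ.m⊔n≤o⇒n≤o L R N≤n
      in subst (∣ seq x m ℚ.* seq y m ℚ.- seq x n ℚ.* seq y n ∣ <_) Kη≡ε
        (*-estimate (seq x m) (seq y m) (seq x n) (seq y n) A B η 0<A 0<B
          (x≤A m (ℕ.m⊔n≤o⇒m≤o N₁ N₂ L≤m))
          (y≤B n (ℕ.m⊔n≤o⇒n≤o N₁ N₂ L≤n))
          (c₂ m n (ℕ.m⊔n≤o⇒n≤o N₃ N₄ R≤m) (ℕ.m⊔n≤o⇒n≤o N₃ N₄ R≤n))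
          (c₁ m n (ℕ.m⊔n≤o⇒m≤o N₃ N₄ R≤m) (ℕ.m⊔n≤o⇒m≤o N₃ N₄ R≤n)))

∣_∣ℝ : ℝ → ℝ
∣ x ∣ℝ = mkℝ (λ n → ∣ seq x n ∣) c
  where
  split : ∀ a b → (a ℚ.- b) ℚ.+ b ≡ a
  split = solve 2 (λ a b → (a :- b) :+ b := a) refl

  cancel : ∀ a b → (a ℚ.+ b) ℚ.- b ≡ a
  cancel = solve 2 (λ a b → (a :+ b) :- b := a) refl

  swap : ∀ a b → ℚ.- (a ℚ.- b) ≡ b ℚ.- a
  swap = solve 2 (λ a b → :- (a :- b) := b :- a) refl

  open ℚ.≤-Reasoning
  half : ∀ a b → ∣ a ∣ ℚ.- ∣ b ∣ ≤ ∣ a ℚ.- b ∣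
  half a b = begin
    ∣ a ∣ ℚ.- ∣ b ∣                      ≡⟨ cong (λ t → ∣ t ∣ ℚ.- ∣ b ∣) (split a b) ⟨
    ∣ (a ℚ.- b) ℚ.+ b ∣ ℚ.- ∣ b ∣        ≤⟨ ℚ.+-monoˡ-≤ (ℚ.- ∣ b ∣) (ℚ.∣p+q∣≤∣p∣+∣q∣ (a ℚ.- b) b) ⟩
    (∣ a ℚ.- b ∣ ℚ.+ ∣ b ∣) ℚ.- ∣ b ∣    ≡⟨ cancel ∣ a ℚ.- b ∣ ∣ b ∣ ⟩
    ∣ a ℚ.- b ∣                          ∎

  reverse-triangle : ∀ a b → ∣ ∣ a ∣ ℚ.- ∣ b ∣ ∣ ≤ ∣ a ℚ.- b ∣
  reverse-triangle a b with ℚ.∣p∣≡p∨∣p∣≡-p (∣ a ∣ ℚ.- ∣ b ∣)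
  ... | inj₁ eq = subst (_≤ ∣ a ℚ.- b ∣) (sym eq) (half a b)
  ... | inj₂ eq = begin
    ∣ ∣ a ∣ ℚ.- ∣ b ∣ ∣    ≡⟨ trans eq (swap ∣ a ∣ ∣ b ∣) ⟩
    ∣ b ∣ ℚ.- ∣ a ∣        ≤⟨ half b a ⟩
    ∣ b ℚ.- a ∣            ≡⟨ cong ∣_∣ (swap a b) ⟨
    ∣ ℚ.- (a ℚ.- b) ∣      ≡⟨ ℚ.∣-p∣≡∣p∣ (a ℚ.- b) ⟩
    ∣ a ℚ.- b ∣            ∎

  c : ∀ ε → 0ℚ < ε → ∃ λ N → ∀ m n → N ℕ.≤ m → N ℕ.≤ n →
      ∣ ∣ seq x m ∣ ℚ.- ∣ seq x n ∣ ∣ < ε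
  c ε 0<ε with cauchy x ε 0<ε
  ... | N , c₁ = N , λ m n N≤m N≤n →
    ℚ.≤-<-trans (reverse-triangle (seq x m) (seq x n)) (c₁ m n N≤m N≤n)

ℝ-rawRing : RawRing 0ℓ 0ℓ
ℝ-rawRing = record
  { Carrier = ℝ ; _≈_ = _≃ℝ_ ; _+_ = _+ℝ_ ; _*_ = _*ℝ_ ; -_ = -ℝ_ ; 0# = 0ℝ ; 1# = 1ℝ }

open RawMonoidDefs (RawRing.+-rawMonoid ℝ-rawRing) public using () renaming (sum to ∑ℝ)
open RawMonoidDefs (RawRing.*-rawMonoid ℝ-rawRing) public using () renaming (sum to ∏ℝ)
open RawSemiringDefs (RawRing.rawSemiring ℝ-rawRing) public using () renaming (_^_ to _^ℝ_)

------------------------------------------------------------------------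
-- Square matrices and their eigenvalues

Matrix : Set → ℕ → Set
Matrix A n = Vector (Vector A n) n

-- Laplace expansion along the first row
det : ∀ {n} → Matrix ℝ n → ℝ
det {zero}  A = 1ℝ
det {suc n} A = ∑ℝ λ j →
  ((-ℝ 1ℝ) ^ℝ toℕ j) *ℝ A zero j *ℝ det (λ i → Vector.removeAt (A (suc i)) j)

scalar : ∀ {n} → ℝ → Matrix ℝ n
scalar x i j = if ⌊ i Fin.≟ j ⌋ then x else 0ℝ

-- The characteristic polynomial, as a polynomial function on ℝ
charpoly : ∀ {n} → Matrix ℝ n → ℝ → ℝ
charpoly A x = det λ i j → scalar x i j -ℝ A i j

-- μ lists the eigenvalues of A with multiplicity: the characteristic
-- polynomial is the product of the linear factors (x - μᵢ).
HasEigenvalues : ∀ {n} → Matrix ℝ n → Vector ℝ n → Set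
HasEigenvalues A μ = ∀ x → charpoly A x ≃ℝ ∏ℝ (λ i → x -ℝ μ i)

-- e is the sum of the absolute values of the eigenvalues.  This is a relation
-- because the eigenvalues are determined by the matrix only up to order and
-- _≃ℝ_; that a symmetric matrix has n real eigenvalues is the spectral theorem.
IsMatrixEnergy : ∀ {n} → Matrix ℝ n → ℝ → Set
IsMatrixEnergy A e = ∃ λ μ → HasEigenvalues A μ × e ≃ℝ ∑ℝ (λ i → ∣ μ i ∣ℝ)

fromℕ-matrix : ∀ {n} → Matrix ℕ n → Matrix ℝ n
fromℕ-matrix A i j = fromℚ (+ A i j ℚ./ 1)

------------------------------------------------------------------------
-- Finite simple graphs

record Graph (n : ℕ) : Set₁ where
  infix 4 _~_ _~?_
  field
    _~_    : Rel (Fin n) 0ℓ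
    _~?_   : Decidable _~_
    sym~   : Symmetric _~_
    irrefl : Irreflexive _≡_ _~_

K : ∀ n → Graph n
K n = record
  { _~_    = _≢_
  ; _~?_   = λ u v → ¬? (u Fin.≟ v)
  ; sym~   = ≢-sym
  ; irrefl = λ u≡v u≢v → u≢v u≡v
  }

infix 4 _≅_
_≅_ : ∀ {m n} → Graph m → Graph n → Set
_≅_ {m} {n} G H = ∃ λ (f : Fin m ↔ Fin n) →
  ∀ u v → (Graph._~_ G u v) ⇔ (Graph._~_ H (Inverse.to f u) (Inverse.to f v))

IsGreatest : (ℕ → Set) → ℕ → Set
IsGreatest P k = P k × (∀ {m} → P m → m ℕ.≤ k)

module _ {n : ℕ} (M : Graph n) where
  open Graph M

  Connected : Set
  Connected = ℕ.NonZero n × (∀ u v → Star _~_ u v)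

  degree : Fin n → ℕ
  degree u = length (filter (u ~?_) (allFin n))

  maxDegree : ℕ
  maxDegree = max 0 (List.map degree (allFin n))

  adjacencyMatrix : Matrix ℕ n
  adjacencyMatrix u v = if ⌊ u ~? v ⌋ then 1 else 0

  -- A path from u to v is given by its list of interior vertices.
  IsPath : Fin n → Fin n → List (Fin n) → Set
  IsPath u v xs = Linked _~_ (u ∷ xs ∷ʳ v) × Unique (u ∷ xs ∷ʳ v)

  -- xs ≢ ys matters only for xs = ys = []: the edge uv, which is disjoint
  -- from itself, may be used once.
  VertexDisjoint : List (Fin n) → List (Fin n) → Set
  VertexDisjoint xs ys = xs ≢ ys × Disjoint xs ys

  HasDisjointPaths : Fin n → Fin n → ℕ → Set
  HasDisjointPaths u v k = ∃ λ Ps →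
    length Ps ≡ k × All (IsPath u v) Ps × AllPairs VertexDisjoint Ps

------------------------------------------------------------------------
-- The maximum number of vertex disjoint paths, by finite search

private
  greatest : ∀ {P : ℕ → Set} → Unary.Decidable P → P 0 →
             ∀ b → (∀ {m} → P m → m ℕ.≤ b) → ∃ (IsGreatest P)
  greatest P? p₀ zero    bnd = 0 , p₀ , bnd
  greatest P? p₀ (suc b) bnd with P? (suc b)
  ... | yes p = suc b , p , bnd
  ... | no ¬p = greatest P? p₀ b λ {m} pm →
    ℕ.≤-pred (ℕ.≤∧≢⇒< (bnd pm) λ { refl → ¬p pm })

  unique⇒length≤ : ∀ {A : Set} {xs ys : List A} → Unique xs → xs ⊆ ys → length xs ℕ.≤ length ys
  unique⇒length≤ {xs = []}     _        _ = z≤n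
  unique⇒length≤ {xs = x ∷ xs} (x∉ ∷ u) s with ∈-∃++ (s (here refl))
  ... | as , bs , refl = begin
    suc (length xs)                ≤⟨ s≤s (unique⇒length≤ u drop-x) ⟩
    suc (length (as ++ bs))        ≡⟨ cong suc (length-++ as) ⟩
    suc (length as ℕ.+ length bs)  ≡⟨ ℕ.+-suc (length as) (length bs) ⟨
    length as ℕ.+ suc (length bs)  ≡⟨ length-++ as ⟨
    length (as ++ x ∷ bs)          ∎
    where
    open ℕ.≤-Reasoning
    drop-x : xs ⊆ as ++ bs
    drop-x z∈ with ∈-++⁻ as (s (there z∈))
    ... | inj₁ z∈as         = ∈-++⁺ˡ z∈as
    ... | inj₂ (here refl)  = contradiction refl (All.lookup x∉ z∈)
    ... | inj₂ (there z∈bs) = ∈-++⁺ʳ as z∈bs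

  words : ∀ {A : Set} → List A → ℕ → List (List A)
  words as zero    = [] ∷ []
  words as (suc k) = cartesianProductWith _∷_ as (words as k)

  ∈-words⁺ : ∀ {A : Set} {as xs : List A} → xs ⊆ as → xs ∈ words as (length xs)
  ∈-words⁺ {xs = []}     _ = here refl
  ∈-words⁺ {xs = x ∷ xs} s =
    ∈-cartesianProductWith⁺ _∷_ (s (here refl)) (∈-words⁺ (s ∘ there))

  ∈-words⁻ : ∀ {A : Set} (as : List A) k {xs} → xs ∈ words as k → length xs ≡ k × xs ⊆ as
  ∈-words⁻ as zero (here refl) = refl , λ ()
  ∈-words⁻ as (suc k) xs∈
    with ∈-cartesianProductWith⁻ _∷_ as (words as k) xs∈
  ... | a , ys , a∈ , ys∈ , refl with ∈-words⁻ as k ys∈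
  ... | eq , s = cong suc eq , λ { (here refl) → a∈ ; (there z∈) → s z∈ }

module _ {n : ℕ} (M : Graph n) (u v : Fin n) where
  open Graph M

  private
    isPath? : Unary.Decidable (IsPath M u v)
    isPath? xs = linked? _~?_ _ ×-dec UniqueDec.unique? Fin._≟_ _

    vertexDisjoint? : Decidable (VertexDisjoint M)
    vertexDisjoint? xs ys =
      ¬? (≡-dec Fin._≟_ xs ys) ×-dec DisjointDec.disjoint? Fin._≟_ xs ys

    candidates : List (List (Fin n))
    candidates = concatMap (words (allFin n)) (upTo (suc n))

    paths : List (List (Fin n))
    paths = filter isPath? candidates

    ∈-paths : ∀ {xs} → IsPath M u v xs → xs ∈ paths
    ∈-paths {xs} p@(_ , _ ∷ uniq) =
      ∈-filter⁺ isPath? (∈-concatMap⁺ (words (allFin n)) (lose (∈-upTo⁺ (s≤s short)) xs∈)) p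
      where
      prefix-unique : ∀ ys → Unique (ys ∷ʳ v) → Unique ys
      prefix-unique []       _       = []
      prefix-unique (y ∷ ys) (a ∷ q) = ++⁻ˡ ys a ∷ prefix-unique ys q

      xs∈ : xs ∈ words (allFin n) (length xs)
      xs∈ = ∈-words⁺ (λ {z} _ → ∈-allFin z)

      short : length xs ℕ.≤ n
      short = subst (length xs ℕ.≤_) (length-tabulate (λ (i : Fin n) → i))
        (unique⇒length≤ (prefix-unique xs uniq) (λ {z} _ → ∈-allFin z))

    bound : ∀ {m} → HasDisjointPaths M u v m → m ℕ.≤ length paths
    bound (Ps , refl , ps , ds) =
      unique⇒length≤ (AllPairs.map proj₁ ds) (∈-paths ∘ All.lookup ps)

    hasDisjointPaths? : Unary.Decidable (HasDisjointPaths M u v)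
    hasDisjointPaths? k = map′ to from (any? (allPairs? vertexDisjoint?) (words paths k))
      where
      to : _ → HasDisjointPaths M u v k
      to any with find any
      ... | Ps , Ps∈ , ds with ∈-words⁻ paths k Ps∈
      ... | eq , s =
        Ps , eq , All.tabulate (λ P∈ → proj₂ (∈-filter⁻ isPath? {xs = candidates} (s P∈))) , ds

      from : HasDisjointPaths M u v k → _
      from (Ps , refl , ps , ds) = lose (∈-words⁺ (∈-paths ∘ All.lookup ps)) ds

  greatestDisjointPaths : ∃ (IsGreatest (HasDisjointPaths M u v))
  greatestDisjointPaths = greatest hasDisjointPaths? ([] , refl , [] , []) (length paths) bound

  maxDisjointPaths : ℕ
  maxDisjointPaths = proj₁ greatestDisjointPaths

  maxDisjointPaths-isGreatest : IsGreatest (HasDisjointPaths M u v) maxDisjointPaths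
  maxDisjointPaths-isGreatest = proj₂ greatestDisjointPaths

------------------------------------------------------------------------
-- Energy and path energy

pathMatrix : ∀ {n} → Graph n → Matrix ℕ n
pathMatrix M u v = if ⌊ u Fin.≟ v ⌋ then 0 else maxDisjointPaths M u v

IsEnergy : ∀ {n} → Graph n → ℝ → Set
IsEnergy M = IsMatrixEnergy (fromℕ-matrix (adjacencyMatrix M))

IsPathEnergy : ∀ {n} → Graph n → ℝ → Set
IsPathEnergy M = IsMatrixEnergy (fromℕ-matrix (pathMatrix M))

{-# OPTIONS --safe #-}

-- The power sums of the eigenvalues are read off the characteristic polynomial:
-- det (x I - A) = xⁿ - (tr A) xⁿ⁻¹ + ½ ((tr A)² - tr A²) xⁿ⁻² + ... , compared with
-- ∏ (x - μᵢ), gives ∑ μᵢ = tr A = 0 and ∑ μᵢ² = tr A².  Cauchy-Schwarz and the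
-- vanishing of ∑ μᵢ then give 2 tr A² ≤ (∑ |μᵢ|)² ≤ n tr A².  Entrywise the
-- adjacency matrix A and the path matrix P satisfy A ≤ P ≤ Δ (disjoint paths
-- leave a vertex through distinct neighbours), so tr A² ≤ tr P² ≤ p (p - 1) Δ²,
-- and both inequalities follow by comparing squares.  For K₂ the lower bound
-- E² ≥ 2 tr A² = 4 equals the square of the right-hand side.
--
-- A real number is a rational sequence and det acts termwise, so all algebra is
-- done over ℚ, for each term of the sequences of the eigenvalues.

module Submission where

open import Defs
open import Algebra.Bundles using (CommutativeRing)
import Algebra.Definitions.RawMonoid as RawMonoidDefs
import Algebra.Definitions.RawSemiring as RawSemiringDefs
import Algebra.Properties.Semiring.Sum as SemiringSum
open import Data.Bool.Base using (if_then_else_; true; false)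
open import Data.Fin.Base using (Fin; zero; suc; toℕ; punchIn)
open import Data.Fin.Permutation using (↔⇒≡)
import Data.Fin.Properties as Fin
import Data.Integer.Base as ℤ
import Data.Integer.Properties as ℤ
open import Data.List.Base as List using (List; []; _∷_; length; filter; allFin)
open import Data.List.Extrema.Nat using (max≤v⁺; xs≤max)
open import Data.List.Membership.Propositional using (_∈_; lose)
open import Data.List.Membership.Propositional.Properties
  using (∈-++⁺ʳ; ∈-filter⁺; ∈-map⁺; ∈-map⁻; ∈-allFin)
open import Data.List.Properties using (length-map; length-tabulate; filter-notAll)
open import Data.List.Relation.Binary.Subset.Propositional using (_⊆_)
open import Data.List.Relation.Unary.All as All using (All; []; _∷_)
import Data.List.Relation.Unary.All.Properties as All
open import Data.List.Relation.Unary.AllPairs using (AllPairs; []; _∷_)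
open import Data.List.Relation.Unary.Any as Any using (here; there)
open import Data.List.Relation.Unary.Linked using (_∷_; [-])
open import Data.List.Relation.Unary.Unique.Propositional using (Unique)
open import Data.Nat.Base as ℕ using (ℕ; zero; suc; z≤n; s≤s)
import Data.Nat.Properties as ℕ
open import Data.Product.Base using (∃; _×_; _,_; proj₁; proj₂)
import Data.Rational.Base as ℚ
import Data.Rational.Properties as ℚ
open import Data.Rational.Solver using (module +-*-Solver)
open import Data.Rational.Unnormalised.Base as ℚᵘ using (mkℚᵘ; *≡*; *≤*)
import Data.Rational.Unnormalised.Properties as ℚᵘ
open import Data.Sum.Base using (inj₁; inj₂)
open import Data.Vec.Functional using (Vector; removeAt) renaming (_∷_ to _◂_)
open import Function.Base using (_∘_; id)
open import Function.Bundles using (Inverse; Equivalence)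
open import Relation.Binary.PropositionalEquality
open import Relation.Nullary.Decidable using (Dec; yes; no; ¬?; ⌊_⌋; ⌊⌋-map′)
open import Relation.Nullary.Negation using (¬_; contradiction)

-- The eigenvalue hypothesis is pointwise: at each `x` the determinant and the product of linear
-- factors agree in the limit, at a rate that depends on `x`, and the two polynomials need not be
-- equal at any index. Their coefficients are therefore compared through growth in `x`. Both sides
-- are expanded to three terms with an error whose constant is uniform in the index, so that a large
-- `x` can be fixed before the index is chosen. The factor p/2 enters as follows. From E² ≤ p tr A²
-- and PE² ≥ 2 tr P² the first inequality needs p ≤ 2 (p/2)², which is p ≥ 2; for a single vertex
-- both traces vanish. In the second inequality the estimate PE² ≤ p tr P² ≤ p² (p - 1) Δ² is
-- smaller than what the bound permits by a further factor p - 1.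

module _ where

  open import Data.Rational.Base using (ℚ; 0ℚ; 1ℚ; ½; ∣_∣; _+_; _-_; -_; _*_; _≤_; _<_)
  open RawSemiringDefs ℚ.+-*-rawSemiring using (_^_)
  open SemiringSum (CommutativeRing.semiring ℚ.+-*-commutativeRing)
    using (sum-cong-≗; ∑-distrib-+) renaming (sum to ∑)
  open RawMonoidDefs ℚ.*-1-rawMonoid using () renaming (sum to ∏)
  open +-*-Solver using (solve; _:+_; _:-_; _:*_; :-_; _:=_; con)

  -- Rational estimates and null sequences

  p≤q⇒0≤q-p : ∀ {p q} → p ≤ q → 0ℚ ≤ q - p
  p≤q⇒0≤q-p {p} {q} p≤q = subst (_≤ q - p) (ℚ.+-inverseʳ p) (ℚ.+-monoˡ-≤ (- p) p≤q)

  0≤q-p⇒p≤q : ∀ {p q} → 0ℚ ≤ q - p → p ≤ q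
  0≤q-p⇒p≤q {p} {q} 0≤d = subst₂ _≤_ (ℚ.+-identityˡ p)
    (solve 2 (λ p q → q :- p :+ p := q) refl p q) (ℚ.+-monoˡ-≤ p 0≤d)

  0≤+ : ∀ {p q} → 0ℚ ≤ p → 0ℚ ≤ q → 0ℚ ≤ p + q
  0≤+ = ℚ.+-mono-≤

  *-monoˡ : ∀ {r p q} → 0ℚ ≤ r → p ≤ q → r * p ≤ r * q
  *-monoˡ {r} 0≤r = ℚ.*-monoˡ-≤-nonNeg r {{ℚ.nonNegative 0≤r}}

  *-monoʳ : ∀ {r p q} → 0ℚ ≤ r → p ≤ q → p * r ≤ q * r
  *-monoʳ {r} 0≤r = ℚ.*-monoʳ-≤-nonNeg r {{ℚ.nonNegative 0≤r}}

  0≤* : ∀ {p q} → 0ℚ ≤ p → 0ℚ ≤ q → 0ℚ ≤ p * q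
  0≤* {p} {q} 0≤p 0≤q = subst (_≤ p * q) (ℚ.*-zeroʳ p) (*-monoˡ 0≤p 0≤q)

  0<* : ∀ {p q} → 0ℚ < p → 0ℚ < q → 0ℚ < p * q
  0<* {p} {q} 0<p 0<q =
    subst (_< p * q) (ℚ.*-zeroʳ p) (ℚ.*-monoʳ-<-pos p {{ℚ.positive 0<p}} 0<q)

  *-mono : ∀ {p p′ q q′} → 0ℚ ≤ p → 0ℚ ≤ q′ → p ≤ p′ → q ≤ q′ → p * q ≤ p′ * q′
  *-mono 0≤p 0≤q′ p≤p′ q≤q′ = ℚ.≤-trans (*-monoˡ 0≤p q≤q′) (*-monoʳ 0≤q′ p≤p′)

  *-cancelʳ : ∀ {p q r} → 0ℚ < r → p * r ≤ q * r → p ≤ q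
  *-cancelʳ {r = r} 0<r = ℚ.*-cancelʳ-≤-pos r {{ℚ.positive 0<r}}

  *-cancelʳ-< : ∀ {p q r} → 0ℚ ≤ r → p * r < q * r → p < q
  *-cancelʳ-< {r = r} 0≤r = ℚ.*-cancelʳ-<-nonNeg r {{ℚ.nonNegative 0≤r}}

  0<½ : 0ℚ < ½
  0<½ = ℚ.positive⁻¹ ½

  0≤1 : 0ℚ ≤ 1ℚ
  0≤1 = ℚ.nonNegative⁻¹ 1ℚ

  0<1 : 0ℚ < 1ℚ
  0<1 = ℚ.positive⁻¹ 1ℚ

  p<1+p : ∀ p → p < 1ℚ + p
  p<1+p p = subst (_< 1ℚ + p) (ℚ.+-identityˡ p) (ℚ.+-monoˡ-< p 0<1)

  ½+½ : ∀ ε → ½ * ε + ½ * ε ≡ ε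
  ½+½ ε = trans (sym (ℚ.*-distribʳ-+ ε ½ ½)) (ℚ.*-identityˡ ε)

  p≤∣p∣ : ∀ p → p ≤ ∣ p ∣
  p≤∣p∣ p with ℚ.≤-total 0ℚ p
  ... | inj₁ 0≤p = ℚ.≤-reflexive (sym (ℚ.0≤p⇒∣p∣≡p 0≤p))
  ... | inj₂ p≤0 = ℚ.≤-trans p≤0 (ℚ.0≤∣p∣ p)

  -p≤∣p∣ : ∀ p → - p ≤ ∣ p ∣
  -p≤∣p∣ p = subst (- p ≤_) (ℚ.∣-p∣≡∣p∣ p) (p≤∣p∣ (- p))

  ∣p∣*∣p∣ : ∀ p → ∣ p ∣ * ∣ p ∣ ≡ p * p
  ∣p∣*∣p∣ p with ℚ.∣p∣≡p∨∣p∣≡-p p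
  ... | inj₁ eq = cong₂ _*_ eq eq
  ... | inj₂ eq = trans (cong₂ _*_ eq eq) (solve 1 (λ p → (:- p) :* (:- p) := p :* p) refl p)

  0≤p*p : ∀ p → 0ℚ ≤ p * p
  0≤p*p p = subst (0ℚ ≤_) (∣p∣*∣p∣ p) (0≤* (ℚ.0≤∣p∣ p) (ℚ.0≤∣p∣ p))

  ∣p-q∣≡∣q-p∣ : ∀ p q → ∣ p - q ∣ ≡ ∣ q - p ∣
  ∣p-q∣≡∣q-p∣ p q = trans (sym (ℚ.∣-p∣≡∣p∣ (p - q)))
    (cong ∣_∣ (solve 2 (λ p q → :- (p :- q) := q :- p) refl p q))

  ∣p∣<q : ∀ {p q} → p < q → - p < q → ∣ p ∣ < q
  ∣p∣<q {p} {q} p<q -p<q with ℚ.∣p∣≡p∨∣p∣≡-p p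
  ... | inj₁ eq = subst (_< q) (sym eq) p<q
  ... | inj₂ eq = subst (_< q) (sym eq) -p<q

  square-reflects-< : ∀ {x y} → 0ℚ ≤ y → x * x < y * y → x < y
  square-reflects-< {x} {y} 0≤y x²<y² with x ℚ.<? y
  ... | yes x<y = x<y
  ... | no  x≮y = contradiction
    (ℚ.≤-<-trans (*-mono 0≤y (ℚ.≤-trans 0≤y y≤x) y≤x y≤x) x²<y²) (ℚ.<-irrefl refl)
    where y≤x = ℚ.≮⇒≥ x≮y

  split-off : ∀ K ε → 0ℚ < K → 0ℚ < ε → ∃ λ η → 0ℚ < η × K * η ≡ ε
  split-off K ε 0<K 0<ε =
    ℚ.1/ K * ε , 0<* (ℚ.positive⁻¹ (ℚ.1/ K) {{ℚ.1/pos⇒pos K}}) 0<ε ,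
    trans (sym (ℚ.*-assoc K (ℚ.1/ K) ε)) (trans (cong (_* ε) (ℚ.*-inverseʳ K)) (ℚ.*-identityˡ ε))
    where
    instance
      K-pos : ℚ.Positive K
      K-pos = ℚ.positive 0<K

      K-nonZero : ℚ.NonZero K
      K-nonZero = ℚ.pos⇒nonZero K

  Eventually : (ℕ → Set) → Set
  Eventually P = ∃ λ N → ∀ n → N ℕ.≤ n → P n

  always : ∀ {P : ℕ → Set} → (∀ n → P n) → Eventually P
  always p = 0 , λ n _ → p n

  ev-map : ∀ {P Q : ℕ → Set} → (∀ n → P n → Q n) → Eventually P → Eventually Q
  ev-map f (N , p) = N , λ n N≤n → f n (p n N≤n)

  ev-zip : ∀ {P Q R : ℕ → Set} → (∀ n → P n → Q n → R n) →
           Eventually P → Eventually Q → Eventually R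
  ev-zip f (N₁ , p) (N₂ , q) = N₁ ℕ.⊔ N₂ , λ n N≤n →
    f n (p n (ℕ.m⊔n≤o⇒m≤o N₁ N₂ N≤n)) (q n (ℕ.m⊔n≤o⇒n≤o N₁ N₂ N≤n))

  -- `x ≃ℝ y` unfolds to `Null` of the difference of the two sequences, so equalities of reals are
  -- accepted by the lemmas below without conversion.
  Null : (ℕ → ℚ) → Set
  Null u = ∀ ε → 0ℚ < ε → Eventually λ n → ∣ u n ∣ < ε

  null-cong : ∀ {u v} → (∀ n → u n ≡ v n) → Null u → Null v
  null-cong eq nu ε 0<ε = ev-map (λ n → subst (λ t → ∣ t ∣ < ε) (eq n)) (nu ε 0<ε)

  null-+ : ∀ (u v : ℕ → ℚ) → Null u → Null v → Null λ n → u n + v n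
  null-+ u v nu nv ε 0<ε = ev-zip
    (λ n u< v< → ℚ.≤-<-trans (ℚ.∣p+q∣≤∣p∣+∣q∣ (u n) (v n))
      (subst (∣ u n ∣ + ∣ v n ∣ <_) (½+½ ε) (ℚ.+-mono-< u< v<)))
    (nu _ (0<* 0<½ 0<ε)) (nv _ (0<* 0<½ 0<ε))

  null-*-bounded : ∀ (u v : ℕ → ℚ) {B} → Null u → 0ℚ ≤ B → Eventually (λ n → ∣ v n ∣ ≤ B) →
                   Null λ n → v n * u n
  null-*-bounded u v {B} nu 0≤B bv ε 0<ε =
    -- Dividing by `1ℚ + B` instead of `B` also covers `B` equal to zero and makes the final
    -- inequality strict.
    let η , 0<η , Kη≡ε = split-off (1ℚ + B) ε (ℚ.+-mono-<-≤ 0<1 0≤B) 0<ε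
    in ev-zip (λ n v≤ u< → begin-strict
         ∣ v n * u n ∣      ≡⟨ ℚ.∣p*q∣≡∣p∣*∣q∣ (v n) (u n) ⟩
         ∣ v n ∣ * ∣ u n ∣  ≤⟨ *-monoʳ (ℚ.0≤∣p∣ (u n)) v≤ ⟩
         B * ∣ u n ∣        ≤⟨ *-monoˡ 0≤B (ℚ.<⇒≤ u<) ⟩
         B * η              <⟨ ℚ.*-monoˡ-<-pos η {{ℚ.positive 0<η}} (p<1+p B) ⟩
         (1ℚ + B) * η       ≡⟨ Kη≡ε ⟩
         ε ∎) bv (nu η 0<η)
    where open ℚ.≤-Reasoning

  null-* : ∀ (u v : ℕ → ℚ) → Null u → Null v → Null λ n → v n * u n
  null-* u v nu nv = null-*-bounded u v nu 0≤1 (ev-map (λ _ → ℚ.<⇒≤) (nv 1ℚ 0<1))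

  null-scale : ∀ (u : ℕ → ℚ) c → Null u → Null λ n → c * u n
  null-scale u c nu = null-*-bounded u (λ _ → c) nu (ℚ.0≤∣p∣ c) (always λ _ → ℚ.≤-refl)

  -- Bounding u n * x for arbitrarily large x bounds u n by C / x.
  null-of-*-bounded : ∀ (u : ℕ → ℚ) C → 0ℚ ≤ C →
    (∀ x → 1ℚ ≤ x → Eventually λ n → ∣ u n ∣ * x ≤ C) → Null u
  null-of-*-bounded u C 0≤C bnd ε 0<ε =
    let y , 0<y , εy≡ = split-off ε (1ℚ + C) 0<ε (ℚ.+-mono-<-≤ 0<1 0≤C)
        x = y + 1ℚ
        0≤x = ℚ.+-mono-≤ (ℚ.<⇒≤ 0<y) 0≤1
        C<εx = begin-strict
          C             <⟨ p<1+p C ⟩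
          1ℚ + C        ≡⟨ εy≡ ⟨
          ε * y         ≤⟨ *-monoˡ (ℚ.<⇒≤ 0<ε) (subst (_≤ x) (ℚ.+-identityʳ y) (ℚ.+-monoʳ-≤ y 0≤1)) ⟩
          ε * x         ∎
    in ev-map (λ n u*x≤C → *-cancelʳ-< 0≤x (ℚ.≤-<-trans u*x≤C C<εx))
         (bnd x (subst (_≤ x) (ℚ.+-identityˡ 1ℚ) (ℚ.+-monoˡ-≤ 1ℚ (ℚ.<⇒≤ 0<y))))
    where open ℚ.≤-Reasoning

  -- Determinants and O(hᵐ) bounds

  sign : ℕ → ℚ
  sign k = (- 1ℚ) ^ k

  detℚ : ∀ {n} → Matrix ℚ n → ℚ
  detℚ {zero}  A = 1ℚ
  detℚ {suc n} A = ∑ λ j → sign (toℕ j) * A zero j * detℚ (λ i → removeAt (A (suc i)) j)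

  detℚ-cong : ∀ {n} {A B : Matrix ℚ n} → (∀ i j → A i j ≡ B i j) → detℚ A ≡ detℚ B
  detℚ-cong {zero}  A≗B = refl
  detℚ-cong {suc n} A≗B = sum-cong-≗ λ j →
    cong₂ (λ a d → sign (toℕ j) * a * d) (A≗B zero j)
      (detℚ-cong λ i k → A≗B (suc i) (punchIn j k))

  scalarℚ : ∀ {n} → ℚ → Matrix ℚ n
  scalarℚ x i j = if ⌊ i Fin.≟ j ⌋ then x else 0ℚ

  charMatrix : ∀ {n} → Matrix ℚ n → ℚ → Matrix ℚ n
  charMatrix A x i j = scalarℚ x i j - A i j

  seq-∑ : ∀ {n} (v : Vector ℝ n) k → seq (∑ℝ v) k ≡ ∑ (λ i → seq (v i) k)
  seq-∑ {zero}  v k = refl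
  seq-∑ {suc n} v k = cong (seq (v zero) k +_) (seq-∑ (v ∘ suc) k)

  seq-∏ : ∀ {n} (v : Vector ℝ n) k → seq (∏ℝ v) k ≡ ∏ (λ i → seq (v i) k)
  seq-∏ {zero}  v k = refl
  seq-∏ {suc n} v k = cong (seq (v zero) k *_) (seq-∏ (v ∘ suc) k)

  seq-^ : ∀ x j k → seq (x ^ℝ j) k ≡ seq x k ^ j
  seq-^ x zero    k = refl
  seq-^ x (suc j) k = cong (seq x k *_) (seq-^ x j k)

  seq-det : ∀ {n} (A : Matrix ℝ n) k → seq (det A) k ≡ detℚ (λ i j → seq (A i j) k)
  seq-det {zero}  A k = refl
  seq-det {suc n} A k = trans (seq-∑ summand k) (sum-cong-≗ λ j →
    cong₂ (λ s d → s * seq (A zero j) k * d) (seq-^ (-ℝ 1ℝ) (toℕ j) k)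
      (seq-det (λ i → removeAt (A (suc i)) j) k))
    where
    summand : Vector ℝ (suc n)
    summand j = ((-ℝ 1ℝ) ^ℝ toℕ j) *ℝ A zero j *ℝ det (λ i → removeAt (A (suc i)) j)

  seq-charpoly : ∀ {n} (A : Matrix ℝ n) x k →
    seq (charpoly A x) k ≡ detℚ (charMatrix (λ i j → seq (A i j) k) (seq x k))
  seq-charpoly A x k = trans (seq-det (λ i j → scalar x i j -ℝ A i j) k)
    (detℚ-cong λ i j → cong (_- seq (A i j) k) (entry i j))
    where
    entry : ∀ i j → seq (scalar x i j) k ≡ scalarℚ (seq x k) i j
    entry i j with ⌊ i Fin.≟ j ⌋
    ... | true  = refl
    ... | false = refl

  1≤*1≤ : ∀ {p q} → 1ℚ ≤ p → 1ℚ ≤ q → 1ℚ ≤ p * q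
  1≤*1≤ 1≤p 1≤q = *-mono 0≤1 (ℚ.≤-trans 0≤1 1≤q) 1≤p 1≤q

  1≤^ : ∀ {p} → 1ℚ ≤ p → ∀ n → 1ℚ ≤ p ^ n
  1≤^ 1≤p zero    = ℚ.≤-refl
  1≤^ 1≤p (suc n) = 1≤*1≤ 1≤p (1≤^ 1≤p n)

  ^-+ : ∀ p m n → p ^ (m ℕ.+ n) ≡ p ^ m * p ^ n
  ^-+ p zero    n = sym (ℚ.*-identityˡ (p ^ n))
  ^-+ p (suc m) n = trans (cong (p *_) (^-+ p m n)) (sym (ℚ.*-assoc p (p ^ m) (p ^ n)))

  -- `X` stays abstract so that a point can later carry an index besides the value `h ξ`. A bound in
  -- `O` holds at every point with one factor, hence uniformly in that index. Since `1 ≤ h`, powers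
  -- of `h` increase with the exponent.
  module Asymptotics {X : Set} (h : X → ℚ) (1≤h : ∀ ξ → 1ℚ ≤ h ξ) where

    record O (m : ℕ) (f : X → ℚ) : Set where
      constructor O-by
      field
        factor   : ℚ
        0≤factor : 0ℚ ≤ factor
        bound    : ∀ ξ → ∣ f ξ ∣ ≤ factor * h ξ ^ m

    0≤^ : ∀ ξ m → 0ℚ ≤ h ξ ^ m
    0≤^ ξ m = ℚ.≤-trans 0≤1 (1≤^ (1≤h ξ) m)

    O-cong : ∀ {m} (f g : X → ℚ) → (∀ ξ → f ξ ≡ g ξ) → O m f → O m g
    O-cong {m} f g f≗g (O-by C 0≤C bnd) =
      O-by C 0≤C λ ξ → subst (λ t → ∣ t ∣ ≤ C * h ξ ^ m) (f≗g ξ) (bnd ξ)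

    O-const : ∀ c → O 0 (λ _ → c)
    O-const c = O-by ∣ c ∣ (ℚ.0≤∣p∣ c) λ ξ → ℚ.≤-reflexive (sym (ℚ.*-identityʳ ∣ c ∣))

    O-zero : ∀ m → O m (λ _ → 0ℚ)
    O-zero m = O-by 0ℚ ℚ.≤-refl λ ξ → ℚ.≤-reflexive (sym (ℚ.*-zeroˡ (h ξ ^ m)))

    O-^ : ∀ m → O m (λ ξ → h ξ ^ m)
    O-^ m = O-by 1ℚ 0≤1 λ ξ →
      ℚ.≤-reflexive (trans (ℚ.0≤p⇒∣p∣≡p (0≤^ ξ m)) (sym (ℚ.*-identityˡ (h ξ ^ m))))

    O-h : O 1 h
    O-h = O-cong _ h (λ ξ → ℚ.*-identityʳ (h ξ)) (O-^ 1)

    O-+ : ∀ {m} (f g : X → ℚ) → O m f → O m g → O m (λ ξ → f ξ + g ξ)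
    O-+ {m} f g (O-by C 0≤C bf) (O-by D 0≤D bg) = O-by (C + D) (0≤+ 0≤C 0≤D) λ ξ → begin
      ∣ f ξ + g ξ ∣              ≤⟨ ℚ.∣p+q∣≤∣p∣+∣q∣ (f ξ) (g ξ) ⟩
      ∣ f ξ ∣ + ∣ g ξ ∣          ≤⟨ ℚ.+-mono-≤ (bf ξ) (bg ξ) ⟩
      C * h ξ ^ m + D * h ξ ^ m  ≡⟨ ℚ.*-distribʳ-+ (h ξ ^ m) C D ⟨
      (C + D) * h ξ ^ m          ∎
      where open ℚ.≤-Reasoning

    O-* : ∀ {m n} (f g : X → ℚ) → O m f → O n g → O (m ℕ.+ n) (λ ξ → f ξ * g ξ)
    O-* {m} {n} f g (O-by C 0≤C bf) (O-by D 0≤D bg) = O-by (C * D) (0≤* 0≤C 0≤D) λ ξ → begin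
      ∣ f ξ * g ξ ∣                  ≡⟨ ℚ.∣p*q∣≡∣p∣*∣q∣ (f ξ) (g ξ) ⟩
      ∣ f ξ ∣ * ∣ g ξ ∣              ≤⟨ *-mono (ℚ.0≤∣p∣ (f ξ)) (0≤* 0≤D (0≤^ ξ n)) (bf ξ) (bg ξ) ⟩
      (C * h ξ ^ m) * (D * h ξ ^ n)
        ≡⟨ solve 4 (λ C D x y → (C :* x) :* (D :* y) := C :* D :* (x :* y)) refl C D (h ξ ^ m) (h ξ ^ n) ⟩
      C * D * (h ξ ^ m * h ξ ^ n)    ≡⟨ cong (C * D *_) (^-+ (h ξ) m n) ⟨
      C * D * h ξ ^ (m ℕ.+ n)        ∎
      where open ℚ.≤-Reasoning

    O-neg : ∀ {m} (f : X → ℚ) → O m f → O m (λ ξ → - f ξ)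
    O-neg {m} f (O-by C 0≤C bf) = O-by C 0≤C λ ξ →
      subst (_≤ C * h ξ ^ m) (sym (ℚ.∣-p∣≡∣p∣ (f ξ))) (bf ξ)

    O-suc : ∀ {m} (f : X → ℚ) → O m f → O (suc m) f
    O-suc {m} f (O-by C 0≤C bf) = O-by C 0≤C λ ξ → ℚ.≤-trans (bf ξ) (*-monoˡ 0≤C
      (subst (_≤ h ξ * h ξ ^ m) (ℚ.*-identityˡ (h ξ ^ m)) (*-monoʳ (0≤^ ξ m) (1≤h ξ))))

    O-h* : ∀ {m} (f : X → ℚ) → O m f → O (suc m) (λ ξ → h ξ * f ξ)
    O-h* f = O-* h f O-h

    O-∑ : ∀ {m n} (f : Fin n → X → ℚ) → (∀ i → O m (f i)) → O m (λ ξ → ∑ λ i → f i ξ)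
    O-∑ {m} {zero}  f of = O-zero m
    O-∑ {m} {suc n} f of =
      O-+ (f zero) (λ ξ → ∑ λ i → f (suc i) ξ) (of zero) (O-∑ (f ∘ suc) (of ∘ suc))

    minor : ∀ {n} → (X → Matrix ℚ (suc n)) → Fin (suc n) → X → Matrix ℚ n
    minor M j ξ i = removeAt (M ξ (suc i)) j

    O-summand : ∀ {l m n} (M : X → Matrix ℚ (suc n)) j →
      O l (λ ξ → M ξ zero j) → O m (detℚ ∘ minor M j) →
      O (l ℕ.+ m) (λ ξ → sign (toℕ j) * M ξ zero j * detℚ (minor M j ξ))
    O-summand {l} M j oa od = O-* (λ ξ → sign (toℕ j) * M ξ zero j) (detℚ ∘ minor M j)
      (O-* _ (λ ξ → M ξ zero j) (O-const (sign (toℕ j))) oa) od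

    O-det : ∀ {n} (M : X → Matrix ℚ n) → (∀ i j → O 1 (λ ξ → M ξ i j)) → O n (λ ξ → detℚ (M ξ))
    O-det {zero}  M oM = O-const 1ℚ
    O-det {suc n} M oM = O-∑ _ λ j →
      O-summand M j (oM zero j) (O-det (minor M j) λ i k → oM (suc i) (punchIn j k))

    -- Every product in the determinant takes exactly one factor from row `r`, so a bounded row
    -- costs one power of `h`. In the expansion along the first row, row `r` either supplies the
    -- entries or survives in every minor.
    O-det-boundedRow : ∀ {n} (M : X → Matrix ℚ (suc n)) → (∀ i j → O 1 (λ ξ → M ξ i j)) →
      ∀ r → (∀ j → O 0 (λ ξ → M ξ r j)) → O n (λ ξ → detℚ (M ξ))
    O-det-boundedRow M oM zero or = O-∑ _ λ j →
      O-summand M j (or j) (O-det (minor M j) λ i k → oM (suc i) (punchIn j k))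
    O-det-boundedRow {suc n} M oM (suc r) or = O-∑ _ λ j →
      O-summand M j (oM zero j)
        (O-det-boundedRow (minor M j) (λ i k → oM (suc i) (punchIn j k)) r (λ k → or (punchIn j k)))

  -- Growth of the characteristic determinant and of its minors

  tr : ∀ {n} → Matrix ℚ n → ℚ
  tr A = ∑ λ i → A i i

  tailMatrix : ∀ {n} → Matrix ℚ (suc n) → Matrix ℚ n
  tailMatrix A i j = A (suc i) (suc j)

  charMatrix-tail : ∀ {n} (A : Matrix ℚ (suc n)) x i j →
    charMatrix A x (suc i) (suc j) ≡ charMatrix (tailMatrix A) x i j
  charMatrix-tail A x i j = cong (λ b → (if b then x else 0ℚ) - A (suc i) (suc j))
    (⌊⌋-map′ (cong suc) Fin.suc-injective (i Fin.≟ j))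

  sign²≡1 : ∀ j → sign j * sign j ≡ 1ℚ
  sign²≡1 zero    = refl
  sign²≡1 (suc j) = trans (solve 1 (λ s → (:- con 1ℚ) :* s :* ((:- con 1ℚ) :* s) := s :* s)
      refl (sign j)) (sign²≡1 j)

  module CharAsymptotics {X : Set} (h : X → ℚ) (1≤h : ∀ ξ → 1ℚ ≤ h ξ) where
    open Asymptotics h 1≤h

    χ : ∀ {n} → Matrix ℚ n → X → Matrix ℚ n
    χ A ξ = charMatrix A (h ξ)

    O-const* : ∀ {m} c (f : X → ℚ) → O m f → O m (λ ξ → c * f ξ)
    O-const* c f of = O-* (λ _ → c) f (O-const c) of

    O-h-minus : ∀ (f : X → ℚ) → O 0 f → O 1 (λ ξ → h ξ - f ξ)
    O-h-minus f of = O-+ h _ O-h (O-suc _ (O-neg f of))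

    O-entry : ∀ {n} (A : Matrix ℚ n) i j → O 1 (λ ξ → χ A ξ i j)
    O-entry A i j with ⌊ i Fin.≟ j ⌋
    ... | true  = O-h-minus _ (O-const (A i j))
    ... | false = O-suc _ (O-const (0ℚ - A i j))

    O-offDiagonal : ∀ {n} (A : Matrix ℚ n) i j → i ≢ j → O 0 (λ ξ → χ A ξ i j)
    O-offDiagonal A i j i≢j with i Fin.≟ j
    ... | yes i≡j = contradiction i≡j i≢j
    ... | no  _   = O-const (0ℚ - A i j)

    O-punctured : ∀ {n} (A : Matrix ℚ (suc n)) i k → O 0 (λ ξ → χ A ξ i (punchIn i k))
    O-punctured A i k = O-offDiagonal A i (punchIn i k) (Fin.punchInᵢ≢i i k ∘ sym)

    summand : ∀ {n} → (X → Matrix ℚ (suc n)) → X → Fin (suc n) → ℚ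
    summand M ξ j = sign (toℕ j) * M ξ zero j * detℚ (minor M j ξ)

    -- Off the diagonal the first row is bounded, and deleting column `suc j` takes the only growing
    -- entry out of row `suc j`, which is row `j` of the minor. Each summand thus loses two powers
    -- of `h` against the full determinant.
    O-laterMinors : ∀ {n} (A : Matrix ℚ (suc n)) → O n (λ ξ → ∑ λ j → summand (χ A) ξ (suc j))
    O-laterMinors {zero}  A = O-zero 0
    -- One power is given away here: the exact exponent would be negative for a 1 by 1 matrix, where
    -- the sum is empty.
    O-laterMinors {suc n} A = O-suc _ (O-∑ _ λ j →
      O-summand (χ A) (suc j) (O-offDiagonal A zero (suc j) λ ())
        (O-det-boundedRow (minor (χ A) (suc j)) (λ i k → O-entry A (suc i) (punchIn (suc j) k))
          j (O-punctured A (suc j))))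

    det-tail : ∀ {n} (A : Matrix ℚ (suc n)) ξ → detℚ (minor (χ A) zero ξ) ≡ detℚ (χ (tailMatrix A) ξ)
    det-tail A ξ = detℚ-cong (charMatrix-tail A (h ξ))

    -- The remainder has order n - 1; multiplying through by `h` keeps the exponent natural at size
    -- zero. Only the first summand of the Laplace expansion reaches the top power, and it is
    -- `h - a` times the same determinant for the tail.
    det-χ-monic : ∀ {n} (A : Matrix ℚ n) →
      O n (λ ξ → h ξ * detℚ (χ A ξ) - h ξ * h ξ ^ n)
    det-χ-monic {zero}  A = O-cong _ _ (λ ξ → sym (ℚ.+-inverseʳ (h ξ * 1ℚ))) (O-zero 0)
    det-χ-monic {suc n} A = O-cong _ _ eq
      (O-+ _ _ (O-+ _ _ (O-* (λ ξ → h ξ - a) L (O-h-minus _ (O-const a)) (det-χ-monic (tailMatrix A)))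
                        (O-neg _ (O-const* a _ (O-^ (suc n)))))
               (O-h* R (O-laterMinors A)))
      where
      a = A zero zero
      D L R : X → ℚ
      D ξ = detℚ (χ (tailMatrix A) ξ)
      L ξ = h ξ * D ξ - h ξ * h ξ ^ n
      R ξ = ∑ λ j → summand (χ A) ξ (suc j)
      eq : ∀ ξ → (h ξ - a) * L ξ - a * (h ξ * h ξ ^ n) + h ξ * R ξ
               ≡ h ξ * detℚ (χ A ξ) - h ξ * h ξ ^ suc n
      eq ξ = trans
        (solve 5 (λ h a D P R → (h :- a) :* (h :* D :- h :* P) :- a :* (h :* P) :+ h :* R :=
                                h :* (con 1ℚ :* (h :- a) :* D :+ R) :- h :* (h :* P))
          refl (h ξ) a (D ξ) (h ξ ^ n) (R ξ))
        (cong (λ d → h ξ * (1ℚ * (h ξ - a) * d + R ξ) - h ξ * (h ξ * h ξ ^ n)) (sym (det-tail A ξ)))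

    -- Up to charMatrix-tail, this is the form of every minor of χ along the first row
    -- except the first one; it recurs in the only minor of full growth of its own.
    bordered : ∀ {m} → Vector ℚ (suc m) → Matrix ℚ (suc m) → Fin (suc m) → X → Matrix ℚ (suc m)
    bordered v A j ξ i = v i ◂ removeAt (χ A ξ i) j

    O-bordered : ∀ {m} v (A : Matrix ℚ (suc m)) j i k → O 1 (λ ξ → bordered v A j ξ i k)
    O-bordered v A j i zero    = O-suc _ (O-const (v i))
    O-bordered v A j i (suc k) = O-entry A i (punchIn j k)

    O-bordered-row : ∀ {m} v (A : Matrix ℚ (suc m)) j k → O 0 (λ ξ → bordered v A j ξ j k)
    O-bordered-row v A j zero    = O-const (v j)
    O-bordered-row v A j (suc k) = O-punctured A j k

    -- To reach the power `m`, each of the `m` columns taken from `χ A` must contribute its diagonal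
    -- entry. This leaves row `j` for the column `v`, whence the coefficient `v j` with the sign of
    -- moving row `j` to the top. The scaling by `h` again avoids a negative exponent.
    det-bordered : ∀ {m} v (A : Matrix ℚ (suc m)) j →
      O m (λ ξ → h ξ * detℚ (bordered v A j ξ) - sign (toℕ j) * v j * (h ξ * h ξ ^ m))
    det-bordered {m} v A zero = O-cong _ _ eq
      (O-+ _ _ (O-const* (v zero) L (det-χ-monic (tailMatrix A))) (OhR A {v}))
      where
      D L R : X → ℚ
      D ξ = detℚ (χ (tailMatrix A) ξ)
      L ξ = h ξ * D ξ - h ξ * h ξ ^ m
      R ξ = ∑ λ j → summand (bordered v A zero) ξ (suc j)
      OhR : ∀ {m} (A : Matrix ℚ (suc m)) {v} →
        O m (λ ξ → h ξ * ∑ λ j → summand (bordered v A zero) ξ (suc j))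
      OhR {zero}  A = O-cong _ _ (λ ξ → sym (ℚ.*-zeroʳ (h ξ))) (O-zero 0)
      -- In the minor for column `suc j`, row `j` consists of `v (suc j)` and off-diagonal entries
      -- of row `suc j`, so it is bounded.
      OhR {suc m} A {v} = O-h* _ (O-∑ _ λ j →
        O-summand (bordered v A zero) (suc j) (O-offDiagonal A zero (suc j) λ ())
          (O-det-boundedRow (minor (bordered v A zero) (suc j))
            (λ i k → O-bordered v A zero (suc i) (punchIn (suc j) k)) j
            λ { zero → O-const (v (suc j)) ; (suc k) → O-punctured A (suc j) (suc k) }))
      eq : ∀ ξ → v zero * L ξ + h ξ * R ξ
               ≡ h ξ * detℚ (bordered v A zero ξ) - 1ℚ * v zero * (h ξ * h ξ ^ m)
      eq ξ = trans
        (solve 5 (λ h v D P R → v :* (h :* D :- h :* P) :+ h :* R :=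
                                h :* (con 1ℚ :* v :* D :+ R) :- con 1ℚ :* v :* (h :* P))
          refl (h ξ) (v zero) (D ξ) (h ξ ^ m) (R ξ))
        (cong (λ d → h ξ * (1ℚ * v zero * d + R ξ) - 1ℚ * v zero * (h ξ * h ξ ^ m)) (sym (det-tail A ξ)))
    -- Row `suc j` is bounded and survives in every minor along the first row, so only the column
    -- with the diagonal entry `h - a` can reach the top power. That column stands in second
    -- position, and its sign -1 turns the `sign (toℕ j)` of the smaller bordered matrix into
    -- `sign (suc (toℕ j))`.
    det-bordered {suc m} v A (suc j) = O-cong _ _ eq
      (O-+ _ _ (O-+ _ _ (O-+ _ _
          (O-const* (v zero) _ (O-h* d₀ Od₀))
          (O-h* R OR))
          (O-neg _ (O-* (λ ξ → h ξ - a) L (O-h-minus _ (O-const a)) (det-bordered (v ∘ suc)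
              (tailMatrix A) j))))
          (O-const* (a * (sign (toℕ j) * v (suc j))) _ (O-^ (suc m))))
      where
      B = bordered v A (suc j)
      a = A zero zero
      d₀ d₁ L R : X → ℚ
      d₀ ξ = detℚ (minor B zero ξ)
      d₁ ξ = detℚ (bordered (v ∘ suc) (tailMatrix A) j ξ)
      L ξ = h ξ * d₁ ξ - sign (toℕ j) * v (suc j) * (h ξ * h ξ ^ m)
      R ξ = ∑ λ k → summand B ξ (suc (suc k))
      O-minor : ∀ k → O m (λ ξ → detℚ (minor B k ξ))
      O-minor k = O-det-boundedRow (minor B k) (λ i l → O-bordered v A (suc j) (suc i) (punchIn k l))
        j (λ l → O-bordered-row v A (suc j) (punchIn k l))
      Od₀ : O m d₀
      Od₀ = O-minor zero
      OR : O m R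
      OR = O-∑ _ λ k → O-summand B (suc (suc k)) (O-offDiagonal A zero (suc (punchIn j k)) λ ())
          (O-minor (suc (suc k)))
      d₁≡ : ∀ ξ → d₁ ξ ≡ detℚ (minor B (suc zero) ξ)
      d₁≡ ξ = detℚ-cong {A = bordered (v ∘ suc) (tailMatrix A) j ξ} {B = minor B (suc zero) ξ}
        λ { i zero → refl ; i (suc k) → sym (charMatrix-tail A (h ξ) i (punchIn j k)) }
      eq : ∀ ξ → v zero * (h ξ * d₀ ξ) + h ξ * R ξ - (h ξ - a) * L ξ
                 + a * (sign (toℕ j) * v (suc j)) * (h ξ * h ξ ^ m)
               ≡ h ξ * detℚ (B ξ) - sign (suc (toℕ j)) * v (suc j) * (h ξ * h ξ ^ suc m)
      eq ξ = trans
        (solve 9 (λ h v₀ d₀ R a d₁ s w P →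
            v₀ :* (h :* d₀) :+ h :* R :- (h :- a) :* (h :* d₁ :- s :* w :* (h :* P)) :+ a :*
                (s :* w) :* (h :* P) :=
            h :* (con 1ℚ :* v₀ :* d₀ :+ ((:- con 1ℚ) :* con 1ℚ :* (h :- a) :* d₁ :+ R)) :-
              (:- con 1ℚ) :* s :* w :* (h :* (h :* P)))
          refl (h ξ) (v zero) (d₀ ξ) (R ξ) a (d₁ ξ) (sign (toℕ j)) (v (suc j)) (h ξ ^ m))
        (cong (λ d → h ξ * (1ℚ * v zero * d₀ ξ + (- 1ℚ * 1ℚ * (h ξ - a) * d + R ξ)) -
                     sign (suc (toℕ j)) * v (suc j) * (h ξ * (h ξ * h ξ ^ m))) (d₁≡ ξ))

  -- The three leading coefficients of the characteristic polynomial

  ∑-comb : ∀ {n} x y (f c : Vector ℚ n) →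
    ∑ (λ j → x * f j + c j * y) ≡ x * ∑ f + ∑ c * y
  ∑-comb {zero}  x y f c = solve 2 (λ x y → con 0ℚ := x :* con 0ℚ :+ con 0ℚ :* y) refl x y
  ∑-comb {suc n} x y f c = trans (cong (x * f zero + c zero * y +_) (∑-comb x y (f ∘ suc) (c ∘ suc)))
    (solve 6 (λ x y f₀ c₀ F C → x :* f₀ :+ c₀ :* y :+ (x :* F :+ C :* y) :=
        x :* (f₀ :+ F) :+ (c₀ :+ C) :* y)
      refl x y (f zero) (c zero) (∑ (f ∘ suc)) (∑ (c ∘ suc)))

  ∑-sq : ∀ {n} → Vector ℚ n → ℚ
  ∑-sq v = ∑ λ i → v i * v i

  -- The second elementary symmetric polynomial, in the recursive form that multiplication by one
  -- more linear factor produces.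
  e₂ : ∀ {n} → Vector ℚ n → ℚ
  e₂ {zero}  v = 0ℚ
  e₂ {suc n} v = e₂ (v ∘ suc) + v zero * ∑ (v ∘ suc)

  e₂-newton : ∀ {n} (v : Vector ℚ n) → e₂ v + e₂ v ≡ ∑ v * ∑ v - ∑-sq v
  e₂-newton {zero}  v = refl
  e₂-newton {suc n} v = trans
    (solve 3 (λ a s e → e :+ a :* s :+ (e :+ a :* s) := e :+ e :+ (a :* s :+ a :* s))
        refl a s (e₂ (v ∘ suc)))
    (trans (cong (_+ (a * s + a * s)) (e₂-newton (v ∘ suc)))
      (solve 3 (λ a s q → s :* s :- q :+ (a :* s :+ a :* s) :=
          (a :+ s) :* (a :+ s) :- (a :* a :+ q)) refl a s (∑-sq (v ∘ suc))))
    where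
    a = v zero
    s = ∑ (v ∘ suc)

  tr-sq : ∀ {n} → Matrix ℚ n → ℚ
  tr-sq A = ∑ λ i → ∑ λ j → A i j * A j i

  cross : ∀ {n} → Matrix ℚ (suc n) → ℚ
  cross A = ∑ λ j → A zero (suc j) * A (suc j) zero

  -- The sum of the principal 2 by 2 minors, split into those avoiding index `zero` and those
  -- containing it. It is the counterpart of `e₂` in the characteristic polynomial.
  minors₂ : ∀ {n} → Matrix ℚ n → ℚ
  minors₂ {zero}  A = 0ℚ
  minors₂ {suc n} A = minors₂ (tailMatrix A) + A zero zero * tr (tailMatrix A) - cross A

  tr-sq-suc : ∀ {n} (A : Matrix ℚ (suc n)) →
    tr-sq A ≡ A zero zero * A zero zero + cross A + (cross A + tr-sq (tailMatrix A))
  tr-sq-suc A = cong (A zero zero * A zero zero + cross A +_) (trans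
    (∑-distrib-+ (λ i → A (suc i) zero * A zero (suc i))
      (λ i → ∑ λ j → A (suc i) (suc j) * A (suc j) (suc i)))
    (cong (_+ tr-sq (tailMatrix A)) (sum-cong-≗ λ i → ℚ.*-comm (A (suc i) zero) (A zero (suc i)))))

  minors₂-newton : ∀ {n} (A : Matrix ℚ n) → minors₂ A + minors₂ A ≡ tr A * tr A - tr-sq A
  minors₂-newton {zero}  A = refl
  minors₂-newton {suc n} A = trans
    (solve 4 (λ a t c m → m :+ a :* t :- c :+ (m :+ a :* t :- c) :=
        m :+ m :+ (a :* t :+ a :* t :- c :- c)) refl a t c (minors₂ A′))
    (trans (cong (_+ (a * t + a * t - c - c)) (minors₂-newton A′))
      (trans (solve 4 (λ a t c q → t :* t :- q :+ (a :* t :+ a :* t :- c :- c) :=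
          (a :+ t) :* (a :+ t) :- (a :* a :+ c :+ (c :+ q))) refl a t c (tr-sq A′))
        (cong (λ q → (a + t) * (a + t) - q) (sym (tr-sq-suc A)))))
    where
    A′ = tailMatrix A
    a = A zero zero
    t = tr A′
    c = cross A

  module Expansion {X : Set} (h : X → ℚ) (1≤h : ∀ ξ → 1ℚ ≤ h ξ) where
    open Asymptotics h 1≤h
    open CharAsymptotics h 1≤h

    leading : ℕ → (X → ℚ) → (X → ℚ) → X → ℚ
    leading n a b ξ = h ξ * (h ξ * (h ξ * h ξ ^ n)) + a ξ * (h ξ * (h ξ * h ξ ^ n)) + b ξ * (h ξ * h ξ ^ n)

    -- f = h ^ n + a h ^ (n - 1) + b h ^ (n - 2) + O (h ^ (n - 3)), multiplied by
    -- h ^ 3 so that no exponent is negative for small n.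
    record Expands (n : ℕ) (a b f : X → ℚ) : Set where
      constructor expands
      field
        bounded₁  : O 0 a
        bounded₂  : O 0 b
        remainder : O n (λ ξ → h ξ * (h ξ * (h ξ * f ξ)) - leading n a b ξ)

    expands-one : Expands 0 (λ _ → 0ℚ) (λ _ → 0ℚ) (λ _ → 1ℚ)
    expands-one = expands (O-const 0ℚ) (O-const 0ℚ) (O-cong _ _ (λ ξ →
      solve 1 (λ h → con 0ℚ := h :* (h :* (h :* con 1ℚ)) :-
          (h :* (h :* (h :* con 1ℚ)) :+ con 0ℚ :* (h :* (h :* con 1ℚ)) :+ con 0ℚ :* (h :* con 1ℚ)))
        refl (h ξ)) (O-zero 0))

    expands-cong : ∀ {n} {a b f a′ b′ f′ : X → ℚ} → (∀ ξ → a ξ ≡ a′ ξ) → (∀ ξ → b ξ ≡ b′ ξ) →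
      (∀ ξ → f ξ ≡ f′ ξ) → Expands n a b f → Expands n a′ b′ f′
    expands-cong {n} a≗ b≗ f≗ (expands oa ob or) =
      expands (O-cong _ _ a≗ oa) (O-cong _ _ b≗ ob) (O-cong _ _ (λ ξ →
        cong₂ _-_ (cong (λ t → h ξ * (h ξ * (h ξ * t))) (f≗ ξ))
          (cong₂ (λ s t → h ξ * (h ξ * (h ξ * h ξ ^ n)) + s * (h ξ * (h ξ * h ξ ^ n)) + t * (h ξ * h ξ ^ n))
            (a≗ ξ) (b≗ ξ))) or)

    -- `μ` may vary with the point, because approximate eigenvalues vary with the index; a constant
    -- diagonal entry is another instance. The new term with coefficient `- μ b` lies one place
    -- below the recorded ones and joins the remainder.
    expands-*linear : ∀ {n} {a b f : X → ℚ} (μ : X → ℚ) → O 0 μ → Expands n a b f →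
      Expands (suc n) (λ ξ → a ξ - μ ξ) (λ ξ → b ξ - μ ξ * a ξ) (λ ξ → (h ξ - μ ξ) * f ξ)
    expands-*linear {n} {a} {b} {f} μ oμ (expands oa ob or) = expands
      (O-+ a _ oa (O-neg μ oμ))
      (O-+ b _ ob (O-neg _ (O-* μ a oμ oa)))
      (O-cong _ _ (λ ξ → solve 6 (λ h μ a b f P →
          (h :- μ) :* (h :* (h :* (h :* f)) :- (h :* (h :* (h :* P)) :+ a :* (h :* (h :* P)) :+ b :*
              (h :* P)))
            :- μ :* b :* (h :* P) :=
          h :* (h :* (h :* ((h :- μ) :* f))) :-
            (h :* (h :* (h :* (h :* P))) :+ (a :- μ) :* (h :* (h :* (h :* P))) :+ (b :- μ :* a) :*
                (h :* (h :* P))))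
          refl (h ξ) (μ ξ) (a ξ) (b ξ) (f ξ) (h ξ ^ n))
        (O-+ _ _ (O-* (λ ξ → h ξ - μ ξ) _ (O-h-minus μ oμ) or)
                 (O-neg _ (O-* (λ ξ → μ ξ * b ξ) _ (O-* μ b oμ ob) (O-^ (suc n))))))

    expands-+ : ∀ {n} {a b f : X → ℚ} (g : X → ℚ) c →
      O n (λ ξ → h ξ * (h ξ * (h ξ * g ξ)) + c * (h ξ * h ξ ^ n)) →
      Expands n a b f → Expands n a (λ ξ → b ξ - c) (λ ξ → f ξ + g ξ)
    expands-+ {n} {a} {b} {f} g c og (expands oa ob or) = expands oa
      (O-+ b _ ob (O-neg _ (O-const c)))
      (O-cong _ _ (λ ξ → solve 7 (λ h a b f P g c →
          (h :* (h :* (h :* f)) :- (h :* (h :* (h :* P)) :+ a :* (h :* (h :* P)) :+ b :* (h :* P)))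
            :+ (h :* (h :* (h :* g)) :+ c :* (h :* P)) :=
          h :* (h :* (h :* (f :+ g))) :-
            (h :* (h :* (h :* P)) :+ a :* (h :* (h :* P)) :+ (b :- c) :* (h :* P)))
          refl (h ξ) (a ξ) (b ξ) (f ξ) (h ξ ^ n) (g ξ) c)
        (O-+ _ _ or og))

    expands-∏ : ∀ {n} (μ : Fin n → X → ℚ) → (∀ i → O 0 (μ i)) →
      Expands n (λ ξ → - ∑ (λ i → μ i ξ)) (λ ξ → e₂ (λ i → μ i ξ)) (λ ξ → ∏ (λ i → h ξ - μ i ξ))
    expands-∏ {zero}  μ oμ = expands-one
    expands-∏ {suc n} μ oμ = expands-cong
      (λ ξ → solve 2 (λ m s → (:- s) :- m := :- (m :+ s)) refl (μ zero ξ) (∑ λ i → μ (suc i) ξ))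
      (λ ξ → solve 3 (λ m s e → e :- m :* (:- s) := e :+ m :* s) refl
        (μ zero ξ) (∑ λ i → μ (suc i) ξ) (e₂ λ i → μ (suc i) ξ))
      (λ ξ → refl)
      (expands-*linear (μ zero) (oμ zero) (expands-∏ (μ ∘ suc) (oμ ∘ suc)))

    -- The minor for column `suc j` is a bordered matrix whose first column is the negated first
    -- column of `A` below the diagonal, so `det-bordered` supplies its top coefficient. The sign
    -- found there meets the Laplace sign of opposite parity, and `sign²≡1` leaves
    -- `- A zero (suc j) * A (suc j) zero`.
    O-crossTerms : ∀ {n} (A : Matrix ℚ (suc n)) →
      O (suc n) (λ ξ → h ξ * (h ξ * (h ξ * ∑ λ j → summand (χ A) ξ (suc j)))
                       + cross A * (h ξ * (h ξ * h ξ ^ n)))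
    O-crossTerms {zero}  A = O-cong _ _ (λ ξ →
      solve 1 (λ h → con 0ℚ := h :* (h :* (h :* con 0ℚ)) :+ con 0ℚ :* (h :* (h :* con 1ℚ)))
          refl (h ξ)) (O-zero 1)
    O-crossTerms {suc m} A = O-cong _ _ total (O-∑ _ term)
      where
      term : ∀ j → O (suc (suc m)) (λ ξ → h ξ * (h ξ * h ξ) * summand (χ A) ξ (suc j)
                       + A zero (suc j) * A (suc j) zero * (h ξ * (h ξ * (h ξ * h ξ ^ m))))
      term j = O-cong _ _ eq (O-const* (s * A zero (suc j)) _ (O-h* _ (O-h* L
          (det-bordered (λ i → 0ℚ - A (suc i) zero) (tailMatrix A) j))))
        where
        s = sign (toℕ j)
        a₀ = A zero (suc j)
        a₁ = A (suc j) zero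
        B : X → Matrix ℚ (suc m)
        B = bordered (λ i → 0ℚ - A (suc i) zero) (tailMatrix A) j
        D L : X → ℚ
        D ξ = detℚ (B ξ)
        L ξ = h ξ * D ξ - s * (0ℚ - a₁) * (h ξ * h ξ ^ m)
        D≡ : ∀ ξ → D ξ ≡ detℚ (minor (χ A) (suc j) ξ)
        D≡ ξ = detℚ-cong {A = B ξ} {B = minor (χ A) (suc j) ξ}
          λ { i zero → refl ; i (suc k) → sym (charMatrix-tail A (h ξ) i (punchIn j k)) }
        eq : ∀ ξ → s * a₀ * (h ξ * (h ξ * L ξ))
                 ≡ h ξ * (h ξ * h ξ) * summand (χ A) ξ (suc j) + a₀ * a₁ * (h ξ * (h ξ * (h ξ * h ξ ^ m)))
        eq ξ = trans
          (solve 6 (λ h s a₀ a₁ D P →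
              s :* a₀ :* (h :* (h :* (h :* D :- s :* (con 0ℚ :- a₁) :* (h :* P)))) :=
              h :* (h :* h) :* ((:- con 1ℚ) :* s :* (con 0ℚ :- a₀) :* D) :+ s :* s :* (a₀ :* a₁) :*
                  (h :* (h :* (h :* P))))
            refl (h ξ) s a₀ a₁ (D ξ) (h ξ ^ m))
          (cong₂ (λ d t → h ξ * (h ξ * h ξ) * (sign (suc (toℕ j)) * (0ℚ - a₀) * d) + t * (h ξ *
              (h ξ * (h ξ * h ξ ^ m))))
            (D≡ ξ)
            (trans (cong (_* (a₀ * a₁)) (sign²≡1 (toℕ j))) (ℚ.*-identityˡ (a₀ * a₁))))
      total : ∀ ξ → _ ≡ _
      total ξ = trans
        (∑-comb (h ξ * (h ξ * h ξ)) (h ξ * (h ξ * (h ξ * h ξ ^ m)))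
          (λ j → summand (χ A) ξ (suc j)) (λ j → A zero (suc j) * A (suc j) zero))
        (cong (_+ cross A * (h ξ * (h ξ * (h ξ * h ξ ^ m))))
          (solve 2 (λ h f → h :* (h :* h) :* f := h :* (h :* (h :* f)))
              refl (h ξ) (∑ λ j → summand (χ A) ξ (suc j))))

    -- The recursion is that of the product of linear factors with roots on the diagonal, with one
    -- correction: the later minors lower the third coefficient by `cross A`.
    expands-det : ∀ {n} (A : Matrix ℚ n) →
      Expands n (λ _ → - tr A) (λ _ → minors₂ A) (λ ξ → detℚ (χ A ξ))
    expands-det {zero}  A = expands-one
    expands-det {suc n} A = expands-cong
      (λ ξ → solve 2 (λ a t → (:- t) :- a := :- (a :+ t)) refl a (tr A′))
      (λ ξ → solve 4 (λ a t m c → m :- a :* (:- t) :- c := m :+ a :* t :- c)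
          refl a (tr A′) (minors₂ A′) (cross A))
      (λ ξ → cong (_+ R ξ) (trans
        (cong (_* detℚ (χ A′ ξ)) (sym (ℚ.*-identityˡ (h ξ - a))))
        (cong (1ℚ * (h ξ - a) *_) (sym (det-tail A ξ)))))
      (expands-+ R (cross A) (O-crossTerms A)
        (expands-*linear (λ _ → a) (O-const a) (expands-det A′)))
      where
      a = A zero zero
      A′ = tailMatrix A
      R : X → ℚ
      R ξ = ∑ λ j → summand (χ A) ξ (suc j)

  -- Convergence of the power sums of the eigenvalues

  triangle₃ : ∀ p q r → ∣ p - q - r ∣ ≤ ∣ p ∣ + ∣ q ∣ + ∣ r ∣
  triangle₃ p q r = ℚ.≤-trans (ℚ.∣p-q∣≤∣p∣+∣q∣ (p - q) r) (ℚ.+-monoˡ-≤ ∣ r ∣ (ℚ.∣p-q∣≤∣p∣+∣q∣ p q))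

  ∣p*q∣≡∣p∣*q : ∀ p {q} → 0ℚ ≤ q → ∣ p * q ∣ ≡ ∣ p ∣ * q
  ∣p*q∣≡∣p∣*q p {q} 0≤q = trans (ℚ.∣p*q∣≡∣p∣*∣q∣ p q) (cong (∣ p ∣ *_) (ℚ.0≤p⇒∣p∣≡p 0≤q))

  ≤-scale : ∀ {p q} → 1ℚ ≤ p → 0ℚ ≤ q → q ≤ p * q
  ≤-scale {p} {q} 1≤p 0≤q = subst (_≤ p * q) (ℚ.*-identityˡ q) (*-monoʳ 0≤q 1≤p)

  -- `P` stands for the power xⁿ and `u` for x³δ at one index; `r` is the remainder. Each estimate
  -- solves the expansion for one coefficient and cancels the power of `x` common to the other
  -- terms.
  module CoefficientEstimates (x P u d e C : ℚ) (1≤x : 1ℚ ≤ x) (1≤P : 1ℚ ≤ P) (0≤C : 0ℚ ≤ C)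
    (∣u∣<1 : ∣ u ∣ < 1ℚ) (remainder : ∣ u - (d * (x * (x * P)) + e * (x * P)) ∣ ≤ C * P) where
    open ℚ.≤-Reasoning

    private
      r = u - (d * (x * (x * P)) + e * (x * P))
      0≤x = ℚ.≤-trans 0≤1 1≤x
      0≤P = ℚ.≤-trans 0≤1 1≤P
      1≤xP = 1≤*1≤ 1≤x 1≤P
      0≤xP = ℚ.≤-trans 0≤1 1≤xP

    d-estimate : ∀ B → ∣ e ∣ ≤ B → ∣ d ∣ * x ≤ 1ℚ + C + B
    d-estimate B ∣e∣≤B = *-cancelʳ {r = x * P} (ℚ.<-≤-trans 0<1 1≤xP) (begin
      ∣ d ∣ * x * (x * P)
        ≡⟨ ℚ.*-assoc ∣ d ∣ x (x * P) ⟩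
      ∣ d ∣ * (x * (x * P))
        ≡⟨ ∣p*q∣≡∣p∣*q d (0≤* 0≤x 0≤xP) ⟨
      ∣ d * (x * (x * P)) ∣
        ≡⟨ cong ∣_∣ (solve 3 (λ u v w → v := u :- (u :- (v :+ w)) :- w)
            refl u (d * (x * (x * P))) (e * (x * P))) ⟩
      ∣ u - r - e * (x * P) ∣
        ≤⟨ triangle₃ u r (e * (x * P)) ⟩
      ∣ u ∣ + ∣ r ∣ + ∣ e * (x * P) ∣
        ≤⟨ ℚ.+-mono-≤ (ℚ.+-mono-≤ (ℚ.≤-trans (ℚ.<⇒≤ ∣u∣<1) 1≤xP)
             (ℚ.≤-trans remainder (*-monoˡ 0≤C (≤-scale 1≤x 0≤P))))
             (ℚ.≤-trans (ℚ.≤-reflexive (∣p*q∣≡∣p∣*q e 0≤xP)) (*-monoʳ 0≤xP ∣e∣≤B)) ⟩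
      x * P + C * (x * P) + B * (x * P)
        ≡⟨ solve 3 (λ C B y → y :+ C :* y :+ B :* y := (con 1ℚ :+ C :+ B) :* y) refl C B (x * P) ⟩
      (1ℚ + C + B) * (x * P) ∎)

    -- The term with `d` outweighs the one with `e` by a factor `x`, so `e` can be isolated only
    -- after `d` is known to be small. At a fixed `x` the hypothesis holds eventually once `d` is
    -- null.
    e-estimate : ∣ x * (x * d) ∣ < 1ℚ → ∣ e ∣ * x ≤ 1ℚ + C + 1ℚ
    e-estimate ∣xxd∣<1 = *-cancelʳ {r = P} (ℚ.<-≤-trans 0<1 1≤P) (begin
      ∣ e ∣ * x * P
        ≡⟨ ℚ.*-assoc ∣ e ∣ x P ⟩
      ∣ e ∣ * (x * P)
        ≡⟨ ∣p*q∣≡∣p∣*q e 0≤xP ⟨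
      ∣ e * (x * P) ∣
        ≡⟨ cong ∣_∣ (solve 5 (λ u d x P w → w :=
            u :- (u :- (d :* (x :* (x :* P)) :+ w)) :- x :* (x :* d) :* P)
             refl u d x P (e * (x * P))) ⟩
      ∣ u - r - x * (x * d) * P ∣
        ≤⟨ triangle₃ u r (x * (x * d) * P) ⟩
      ∣ u ∣ + ∣ r ∣ + ∣ x * (x * d) * P ∣
        ≤⟨ ℚ.+-mono-≤ (ℚ.+-mono-≤ (ℚ.≤-trans (ℚ.<⇒≤ ∣u∣<1) 1≤P) remainder)
             (ℚ.≤-trans (ℚ.≤-reflexive (∣p*q∣≡∣p∣*q (x * (x * d)) 0≤P)) (*-monoʳ 0≤P (ℚ.<⇒≤ ∣xxd∣<1))) ⟩
      P + C * P + 1ℚ * P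
        ≡⟨ solve 2 (λ C y → y :+ C :* y :+ con 1ℚ :* y := (con 1ℚ :+ C :+ con 1ℚ) :* y) refl C P ⟩
      (1ℚ + C + 1ℚ) * P ∎)

  -- If x³δ = d xⁿ⁺² + e xⁿ⁺¹ + O(xⁿ) with δ → 0 at every fixed x, then x may be
  -- chosen first and the index afterwards, so that d, and after it e, tends to 0.
  module Coefficients
    (n N : ℕ) (C B : ℚ) (0≤C : 0ℚ ≤ C) (0≤B : 0ℚ ≤ B)
    (d e : ℕ → ℚ) (δ : ℚ → ℕ → ℚ) (δ-null : ∀ x → Null (δ x))
    (remainder : ∀ x → 1ℚ ≤ x → ∀ k → N ℕ.≤ k →
      ∣ x * (x * (x * δ x k)) - (d k * (x * (x * x ^ n)) + e k * (x * x ^ n)) ∣ ≤ C * x ^ n)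
    (e-bounded : ∀ k → N ℕ.≤ k → ∣ e k ∣ ≤ B)
    where

    private
      x³δ : ℚ → ℕ → ℚ
      x³δ x k = x * (x * (x * δ x k))

      x³δ<1 : ∀ x → Eventually λ k → ∣ x³δ x k ∣ < 1ℚ
      x³δ<1 x = null-scale (λ k → x * (x * δ x k)) x
        (null-scale (λ k → x * δ x k) x (null-scale (δ x) x (δ-null x))) 1ℚ 0<1

      module Estimates x (1≤x : 1ℚ ≤ x) k (N≤k : N ℕ.≤ k) (δ<1 : ∣ x³δ x k ∣ < 1ℚ) =
        CoefficientEstimates x (x ^ n) (x³δ x k) (d k) (e k) C 1≤x (1≤^ 1≤x n) 0≤C δ<1
            (remainder x 1≤x k N≤k)

    d-null : Null d
    d-null = null-of-*-bounded d (1ℚ + C + B) (0≤+ (0≤+ 0≤1 0≤C) 0≤B) λ x 1≤x →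
      ev-zip {N ℕ.≤_} {λ k → ∣ x³δ x k ∣ < 1ℚ} {λ k → ∣ d k ∣ * x ≤ 1ℚ + C + B}
        (λ k N≤k δ<1 → Estimates.d-estimate x 1≤x k N≤k δ<1 B (e-bounded k N≤k))
        (N , λ _ N≤k → N≤k) (x³δ<1 x)

    e-null : Null e
    e-null = null-of-*-bounded e (1ℚ + C + 1ℚ) (0≤+ (0≤+ 0≤1 0≤C) 0≤1) λ x 1≤x →
      ev-zip {N ℕ.≤_} {λ k → ∣ x³δ x k ∣ < 1ℚ × ∣ x * (x * d k) ∣ < 1ℚ} {λ k → ∣ e k ∣ * x ≤ 1ℚ + C + 1ℚ}
        (λ k N≤k (δ<1 , d<1) → Estimates.e-estimate x 1≤x k N≤k δ<1 d<1)
        (N , λ _ N≤k → N≤k)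
        (ev-zip (λ _ → _,_) (x³δ<1 x) (null-scale (λ k → x * d k) x (null-scale d x d-null) 1ℚ 0<1))

  cauchy-bounded : ∀ x → ∃ λ N → ∃ λ B → 0ℚ ≤ B × (∀ k → N ℕ.≤ k → ∣ seq x k ∣ ≤ B)
  cauchy-bounded x with cauchy x 1ℚ 0<1
  ... | N , c = N , 1ℚ + ∣ seq x N ∣ , 0≤+ 0≤1 (ℚ.0≤∣p∣ (seq x N)) , λ k N≤k → begin
    ∣ seq x k ∣
      ≡⟨ cong ∣_∣ (solve 2 (λ a b → a := a :- b :+ b) refl (seq x k) (seq x N)) ⟩
    ∣ seq x k - seq x N + seq x N ∣  ≤⟨ ℚ.∣p+q∣≤∣p∣+∣q∣ (seq x k - seq x N) (seq x N) ⟩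
    ∣ seq x k - seq x N ∣ + ∣ seq x N ∣
      ≤⟨ ℚ.+-monoˡ-≤ ∣ seq x N ∣ (ℚ.<⇒≤ (c k N N≤k ℕ.≤-refl)) ⟩
    1ℚ + ∣ seq x N ∣ ∎
    where open ℚ.≤-Reasoning

  p≤p+q : ∀ p {q} → 0ℚ ≤ q → p ≤ p + q
  p≤p+q p {q} 0≤q = subst (_≤ p + q) (ℚ.+-identityʳ p) (ℚ.+-monoʳ-≤ p 0≤q)

  p≤q+p : ∀ p {q} → 0ℚ ≤ q → p ≤ q + p
  p≤q+p p {q} 0≤q = subst (_≤ q + p) (ℚ.+-identityˡ p) (ℚ.+-monoˡ-≤ p 0≤q)

  vector-bounded : ∀ {n} (v : Vector ℝ n) →
    ∃ λ N → ∃ λ B → 0ℚ ≤ B × (∀ i k → N ℕ.≤ k → ∣ seq (v i) k ∣ ≤ B)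
  vector-bounded {zero}  v = 0 , 0ℚ , ℚ.≤-refl , λ ()
  vector-bounded {suc n} v =
    let N₁ , B₁ , 0≤B₁ , b₁ = cauchy-bounded (v zero)
        N₂ , B₂ , 0≤B₂ , b₂ = vector-bounded (v ∘ suc)
    in N₁ ℕ.⊔ N₂ , B₁ + B₂ , ℚ.+-mono-≤ {0ℚ} {B₁} {0ℚ} {B₂} 0≤B₁ 0≤B₂ , λ where
      zero    k N≤k → ℚ.≤-trans (b₁ k (ℕ.m⊔n≤o⇒m≤o N₁ N₂ N≤k)) (p≤p+q B₁ 0≤B₂)
      (suc i) k N≤k → ℚ.≤-trans (b₂ i k (ℕ.m⊔n≤o⇒n≤o N₁ N₂ N≤k)) (p≤q+p B₂ 0≤B₁)

  module Spectrum {n} (A : Matrix ℚ n) (μ : Vector ℝ n)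
    (eigenvalues : ∀ x → Null λ k → detℚ (charMatrix A x) - ∏ (λ i → x - seq (μ i) k)) where

    μ[_] : ℕ → Vector ℚ n
    μ[ k ] i = seq (μ i) k

    private
      N = proj₁ (vector-bounded μ)
      B = proj₁ (proj₂ (vector-bounded μ))
      0≤B = proj₁ (proj₂ (proj₂ (vector-bounded μ)))
      μ-bounded = proj₂ (proj₂ (proj₂ (vector-bounded μ)))

      -- The parameter set for `O`: all evaluation points from 1 on, paired with all indices past
      -- the stage where the approximate eigenvalues are bounded by `B`. The resulting factors
      -- depend on neither component.
      record Point : Set where
        constructor point
        field
          index   : ℕ
          N≤index : N ℕ.≤ index
          x       : ℚ
          1≤x     : 1ℚ ≤ x
      open Point

      open Asymptotics x 1≤x
      open Expansion x 1≤x

      d e : ℕ → ℚ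
      d k = ∑ μ[ k ] - tr A
      e k = minors₂ A - e₂ μ[ k ]

      δ : ℚ → ℕ → ℚ
      δ y k = detℚ (charMatrix A y) - ∏ (λ i → y - μ[ k ] i)

      det-expands : Expands n (λ _ → - tr A) (λ _ → minors₂ A) (λ ξ → detℚ (charMatrix A (x ξ)))
      det-expands = expands-det A

      ∏-expands : Expands n (λ ξ → - ∑ μ[ index ξ ]) (λ ξ → e₂ μ[ index ξ ])
        (λ ξ → ∏ (λ i → x ξ - μ[ index ξ ] i))
      ∏-expands = expands-∏ (λ i ξ → μ[ index ξ ] i) λ i → O-by B 0≤B λ ξ →
        subst (∣ μ[ index ξ ] i ∣ ≤_) (sym (ℚ.*-identityʳ B)) (μ-bounded i (index ξ) (N≤index ξ))

      e-O : O 0 (λ ξ → e (index ξ))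
      e-O = O-+ _ _ (O-const (minors₂ A)) (O-neg _ (Expands.bounded₂ ∏-expands))

      -- Both expansions are monic, so the top powers cancel and the coefficient differences `d` and
      -- `e` remain.
      difference : O n (λ ξ → x ξ * (x ξ * (x ξ * δ (x ξ) (index ξ))) -
        (d (index ξ) * (x ξ * (x ξ * x ξ ^ n)) + e (index ξ) * (x ξ * x ξ ^ n)))
      difference = O-cong _ _ (λ ξ → solve 8 (λ x P f g t s m e →
          x :* (x :* (x :* f)) :- (x :* (x :* (x :* P)) :+ (:- t) :* (x :* (x :* P)) :+ m :* (x :* P))
            :- (x :* (x :* (x :* g)) :- (x :* (x :* (x :* P)) :+ (:- s) :* (x :* (x :* P)) :+ e :*
                (x :* P))) :=
          x :* (x :* (x :* (f :- g))) :- ((s :- t) :* (x :* (x :* P)) :+ (m :- e) :* (x :* P)))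
          refl (x ξ) (x ξ ^ n) (detℚ (charMatrix A (x ξ))) (∏ (λ i → x ξ - μ[ index ξ ] i))
               (tr A) (∑ μ[ index ξ ]) (minors₂ A) (e₂ μ[ index ξ ]))
        (O-+ _ _ (Expands.remainder det-expands) (O-neg _ (Expands.remainder ∏-expands)))

      open Coefficients n N (O.factor difference) (O.factor e-O) (O.0≤factor difference) (O.0≤factor e-O)
        d e δ eigenvalues (λ y 1≤y k N≤k → O.bound difference (point k N≤k y 1≤y))
        -- A bound of order zero does not depend on `x`, so it is read off at the point with
        -- `x = 1`.
        (λ k N≤k → subst (∣ e k ∣ ≤_) (ℚ.*-identityʳ (O.factor e-O)) (O.bound e-O
            (point k N≤k 1ℚ ℚ.≤-refl)))

    ∑μ→tr : Null λ k → ∑ μ[ k ] - tr A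
    ∑μ→tr = d-null

    -- The two Newton identities turn the difference into d² + 2 (tr A) d + 2 e, a sum of null
    -- sequences.
    ∑μ²→tr-sq : Null λ k → ∑-sq μ[ k ] - tr-sq A
    ∑μ²→tr-sq = null-cong eq
      (null-+ _ _ (null-+ _ _ (null-* d d d-null d-null) (null-scale d (tr A + tr A) d-null))
                  (null-+ e e e-null e-null))
      where
      eq : ∀ k → d k * d k + (tr A + tr A) * d k + (e k + e k) ≡ ∑-sq μ[ k ] - tr-sq A
      eq k = trans
        (solve 4 (λ s t m e → (s :- t) :* (s :- t) :+ (t :+ t) :* (s :- t) :+ (m :- e :+ (m :- e)) :=
                              s :* s :- t :* t :+ (m :+ m) :- (e :+ e))
          refl (∑ μ[ k ]) (tr A) (minors₂ A) (e₂ μ[ k ]))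
        (trans (cong₂ (λ p q → ∑ μ[ k ] * ∑ μ[ k ] - tr A * tr A + p - q) (minors₂-newton A)
            (e₂-newton μ[ k ]))
          (solve 4 (λ s t S T → s :* s :- t :* t :+ (t :* t :- T) :- (s :* s :- S) := S :- T)
            refl (∑ μ[ k ]) (tr A) (∑-sq μ[ k ]) (tr-sq A)))

  -- Power sums against absolute sums, and traces of natural number matrices

  ι : ℕ → ℚ
  ι n = ℤ.+ n ℚ./ 1

  toℚᵘ-ι : ∀ n → ℚ.toℚᵘ (ι n) ℚᵘ.≃ mkℚᵘ (ℤ.+ n) 0
  toℚᵘ-ι n = ℚ.toℚᵘ-fromℚᵘ (mkℚᵘ (ℤ.+ n) 0)

  ι-+ : ∀ m n → ι (m ℕ.+ n) ≡ ι m + ι n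
  ι-+ m n = ℚ.toℚᵘ-injective (begin
    ℚ.toℚᵘ (ι (m ℕ.+ n))              ≈⟨ toℚᵘ-ι (m ℕ.+ n) ⟩
    mkℚᵘ (ℤ.+ (m ℕ.+ n)) 0
      ≈⟨ *≡* (cong (ℤ._* ℤ.+ 1) (cong₂ ℤ._+_ (sym (ℤ.*-identityʳ (ℤ.+ m))) (sym (ℤ.*-identityʳ (ℤ.+ n))))) ⟩
    mkℚᵘ (ℤ.+ m) 0 ℚᵘ.+ mkℚᵘ (ℤ.+ n) 0    ≈⟨ ℚᵘ.+-cong (toℚᵘ-ι m) (toℚᵘ-ι n) ⟨
    ℚ.toℚᵘ (ι m) ℚᵘ.+ ℚ.toℚᵘ (ι n)    ≈⟨ ℚ.toℚᵘ-homo-+ (ι m) (ι n) ⟨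
    ℚ.toℚᵘ (ι m + ι n)                ∎)
    where open ℚᵘ.≃-Reasoning

  ι-* : ∀ m n → ι (m ℕ.* n) ≡ ι m * ι n
  ι-* m n = ℚ.toℚᵘ-injective (begin
    ℚ.toℚᵘ (ι (m ℕ.* n))              ≈⟨ toℚᵘ-ι (m ℕ.* n) ⟩
    mkℚᵘ (ℤ.+ (m ℕ.* n)) 0              ≈⟨ *≡* (cong (ℤ._* ℤ.+ 1) (ℤ.pos-* m n)) ⟩
    mkℚᵘ (ℤ.+ m) 0 ℚᵘ.* mkℚᵘ (ℤ.+ n) 0    ≈⟨ ℚᵘ.*-cong (toℚᵘ-ι m) (toℚᵘ-ι n) ⟨
    ℚ.toℚᵘ (ι m) ℚᵘ.* ℚ.toℚᵘ (ι n)    ≈⟨ ℚ.toℚᵘ-homo-* (ι m) (ι n) ⟨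
    ℚ.toℚᵘ (ι m * ι n)                ∎)
    where open ℚᵘ.≃-Reasoning

  n/2≡½*ι : ∀ n → ℤ.+ n ℚ./ 2 ≡ ½ * ι n
  n/2≡½*ι n = ℚ.toℚᵘ-injective (begin
    ℚ.toℚᵘ (ℤ.+ n ℚ./ 2)                ≈⟨ ℚ.toℚᵘ-fromℚᵘ (mkℚᵘ (ℤ.+ n) 1) ⟩
    mkℚᵘ (ℤ.+ n) 1                      ≈⟨ *≡* (cong (ℤ._* ℤ.+ 2) (sym (ℤ.*-identityˡ (ℤ.+ n)))) ⟩
    mkℚᵘ (ℤ.+ 1) 1 ℚᵘ.* mkℚᵘ (ℤ.+ n) 0    ≈⟨ ℚᵘ.*-congˡ {mkℚᵘ (ℤ.+ 1) 1} (toℚᵘ-ι n) ⟨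
    ℚ.toℚᵘ ½ ℚᵘ.* ℚ.toℚᵘ (ι n)        ≈⟨ ℚ.toℚᵘ-homo-* ½ (ι n) ⟨
    ℚ.toℚᵘ (½ * ι n)                  ∎)
    where open ℚᵘ.≃-Reasoning

  ι-mono : ∀ {m n} → m ℕ.≤ n → ι m ≤ ι n
  ι-mono {m} {n} m≤n = ℚ.toℚᵘ-cancel-≤ (begin
    ℚ.toℚᵘ (ι m)  ≃⟨ toℚᵘ-ι m ⟩
    mkℚᵘ (ℤ.+ m) 0  ≤⟨ *≤* (ℤ.*-monoʳ-≤-nonNeg (ℤ.+ 1) (ℤ.+≤+ m≤n)) ⟩
    mkℚᵘ (ℤ.+ n) 0  ≃⟨ toℚᵘ-ι n ⟨
    ℚ.toℚᵘ (ι n)  ∎)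
    where open ℚᵘ.≤-Reasoning

  0≤ι : ∀ n → 0ℚ ≤ ι n
  0≤ι n = ι-mono {0} {n} ℕ.z≤n

  -- Absolute sums against sums of squares

  ∑∣_∣ : ∀ {n} → Vector ℚ n → ℚ
  ∑∣ v ∣ = ∑ λ i → ∣ v i ∣

  0≤∑∣∣ : ∀ {n} (v : Vector ℚ n) → 0ℚ ≤ ∑∣ v ∣
  0≤∑∣∣ {zero}  v = ℚ.≤-refl
  0≤∑∣∣ {suc n} v = 0≤+ (ℚ.0≤∣p∣ (v zero)) (0≤∑∣∣ (v ∘ suc))

  ∣∑∣≤∑∣∣ : ∀ {n} (v : Vector ℚ n) → ∣ ∑ v ∣ ≤ ∑∣ v ∣
  ∣∑∣≤∑∣∣ {zero}  v = ℚ.≤-refl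
  ∣∑∣≤∑∣∣ {suc n} v = ℚ.≤-trans (ℚ.∣p+q∣≤∣p∣+∣q∣ (v zero) (∑ (v ∘ suc)))
    (ℚ.+-monoʳ-≤ ∣ v zero ∣ (∣∑∣≤∑∣∣ (v ∘ suc)))

  -- Summing 2ab ≤ a² + b² over the entries. With `a` the absolute value of a new entry this
  -- controls the mixed term in the induction for Cauchy-Schwarz.
  2a∑∣∣≤na²+∑² : ∀ {n} a (v : Vector ℚ n) → (a + a) * ∑∣ v ∣ ≤ ι n * (a * a) + ∑-sq v
  2a∑∣∣≤na²+∑² {zero}  a v = ℚ.≤-reflexive
    (solve 1 (λ a → (a :+ a) :* con 0ℚ := con 0ℚ :* (a :* a) :+ con 0ℚ) refl a)
  2a∑∣∣≤na²+∑² {suc n} a v = begin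
    (a + a) * (b + s)
      ≡⟨ solve 3 (λ a b s → (a :+ a) :* (b :+ s) := (a :+ a) :* b :+ (a :+ a) :* s) refl a b s ⟩
    (a + a) * b + (a + a) * s
      ≤⟨ ℚ.+-mono-≤ am-gm (2a∑∣∣≤na²+∑² a (v ∘ suc)) ⟩
    a * a + b * b + (ι n * (a * a) + ∑-sq (v ∘ suc))
      ≡⟨ solve 4 (λ a b n q → a :* a :+ b :* b :+ (n :* (a :* a) :+ q) :=
          (con 1ℚ :+ n) :* (a :* a) :+ (b :* b :+ q)) refl a b (ι n) (∑-sq (v ∘ suc)) ⟩
    (1ℚ + ι n) * (a * a) + (b * b + ∑-sq (v ∘ suc))
      ≡⟨ cong₂ (λ m c → m * (a * a) + (c + ∑-sq (v ∘ suc))) (sym (ι-+ 1 n)) (∣p∣*∣p∣ (v zero)) ⟩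
    ι (suc n) * (a * a) + (v zero * v zero + ∑-sq (v ∘ suc)) ∎
    where
    open ℚ.≤-Reasoning
    b = ∣ v zero ∣
    s = ∑∣ v ∘ suc ∣
    am-gm : (a + a) * b ≤ a * a + b * b
    am-gm = 0≤q-p⇒p≤q (subst (0ℚ ≤_)
      (solve 2 (λ a b → (a :- b) :* (a :- b) := a :* a :+ b :* b :- (a :+ a) :* b)
          refl a b) (0≤p*p (a - b)))

  ∑∣∣²≤n∑² : ∀ {n} (v : Vector ℚ n) → ∑∣ v ∣ * ∑∣ v ∣ ≤ ι n * ∑-sq v
  ∑∣∣²≤n∑² {zero}  v = ℚ.≤-refl
  ∑∣∣²≤n∑² {suc n} v = begin
    (b + s) * (b + s)
      ≡⟨ solve 2 (λ b s → (b :+ s) :* (b :+ s) := b :* b :+ (b :+ b) :* s :+ s :* s) refl b s ⟩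
    b * b + (b + b) * s + s * s
      ≤⟨ ℚ.+-mono-≤ (ℚ.+-monoʳ-≤ (b * b) (2a∑∣∣≤na²+∑² b (v ∘ suc))) (∑∣∣²≤n∑² (v ∘ suc)) ⟩
    b * b + (ι n * (b * b) + q) + ι n * q
      ≡⟨ solve 3 (λ b n q → b :* b :+ (n :* (b :* b) :+ q) :+ n :* q :=
          (con 1ℚ :+ n) :* (b :* b :+ q)) refl b (ι n) q ⟩
    (1ℚ + ι n) * (b * b + q)
      ≡⟨ cong₂ (λ m c → m * (c + q)) (sym (ι-+ 1 n)) (∣p∣*∣p∣ (v zero)) ⟩
    ι (suc n) * (v zero * v zero + q) ∎
    where
    open ℚ.≤-Reasoning
    b = ∣ v zero ∣
    s = ∑∣ v ∘ suc ∣
    q = ∑-sq (v ∘ suc)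

  -- On expanding the right-hand side, every mixed pair contributes a multiple of ∣vᵢvⱼ∣ + vᵢvⱼ,
  -- which is not negative. The term `∑ v * ∑ v` is kept because at a finite index the sum of the
  -- approximate eigenvalues is only close to zero.
  2∑²≤∑∣∣²+∑² : ∀ {n} (v : Vector ℚ n) → ∑-sq v + ∑-sq v ≤ ∑∣ v ∣ * ∑∣ v ∣ + ∑ v * ∑ v
  2∑²≤∑∣∣²+∑² {zero}  v = ℚ.≤-refl
  2∑²≤∑∣∣²+∑² {suc n} v = begin
    a * a + q + (a * a + q)
      ≡⟨ cong (λ c → c + q + (a * a + q)) (∣p∣*∣p∣ a) ⟨
    b * b + q + (a * a + q)
      ≡⟨ solve 3 (λ a b q → b :* b :+ q :+ (a :* a :+ q) := b :* b :+ a :* a :+ (q :+ q)) refl a b q ⟩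
    b * b + a * a + (q + q)
      ≤⟨ ℚ.+-monoʳ-≤ (b * b + a * a) (2∑²≤∑∣∣²+∑² (v ∘ suc)) ⟩
    b * b + a * a + (S * S + s * s)
      ≤⟨ p≤p+q (b * b + a * a + (S * S + s * s)) (0≤+ cross-terms cross-terms) ⟩
    b * b + a * a + (S * S + s * s) + (b * S + a * s + (b * S + a * s))
      ≡⟨ solve 4 (λ a b S s →
          b :* b :+ a :* a :+ (S :* S :+ s :* s) :+ (b :* S :+ a :* s :+ (b :* S :+ a :* s)) :=
           (b :+ S) :* (b :+ S) :+ (a :+ s) :* (a :+ s)) refl a b S s ⟩
    (b + S) * (b + S) + (a + s) * (a + s) ∎
    where
    open ℚ.≤-Reasoning
    a = v zero
    b = ∣ v zero ∣
    S = ∑∣ v ∘ suc ∣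
    s = ∑ (v ∘ suc)
    q = ∑-sq (v ∘ suc)
    -as≤bS : - (a * s) ≤ b * S
    -as≤bS = begin
      - (a * s)      ≤⟨ -p≤∣p∣ (a * s) ⟩
      ∣ a * s ∣      ≡⟨ ℚ.∣p*q∣≡∣p∣*∣q∣ a s ⟩
      ∣ a ∣ * ∣ s ∣  ≤⟨ *-monoˡ (ℚ.0≤∣p∣ a) (∣∑∣≤∑∣∣ (v ∘ suc)) ⟩
      b * S          ∎
    cross-terms : 0ℚ ≤ b * S + a * s
    cross-terms = subst (0ℚ ≤_) (solve 2 (λ x y → x :- (:- y) := x :+ y)
        refl (b * S) (a * s)) (p≤q⇒0≤q-p -as≤bS)

  ∑-mono : ∀ {n} (f g : Vector ℚ n) → (∀ i → f i ≤ g i) → ∑ f ≤ ∑ g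
  ∑-mono {zero}  f g f≤g = ℚ.≤-refl
  ∑-mono {suc n} f g f≤g = ℚ.+-mono-≤ (f≤g zero) (∑-mono (f ∘ suc) (g ∘ suc) (f≤g ∘ suc))

  ∑≤n*max : ∀ {n} c (f : Vector ℚ n) → (∀ i → f i ≤ c) → ∑ f ≤ ι n * c
  ∑≤n*max {zero}  c f f≤c = ℚ.≤-reflexive (sym (ℚ.*-zeroˡ c))
  ∑≤n*max {suc n} c f f≤c = ℚ.≤-trans (ℚ.+-mono-≤ (f≤c zero) (∑≤n*max c (f ∘ suc) (f≤c ∘ suc)))
    (ℚ.≤-reflexive (trans (solve 2 (λ n c → c :+ n :* c := (con 1ℚ :+ n) :* c) refl (ι n) c)
      (cong (_* c) (sym (ι-+ 1 n)))))

  -- The zero on the diagonal saves one summand in each row; this is the origin of the factor p - 1.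
  ∑≤pred*max : ∀ {n} c (f : Vector ℚ (suc n)) → (∀ i → f i ≤ c) → ∀ i → f i ≡ 0ℚ → ∑ f ≤ ι n * c
  ∑≤pred*max {n} c f f≤c zero fᵢ≡0 = begin
    f zero + ∑ (f ∘ suc)  ≡⟨ cong (_+ ∑ (f ∘ suc)) fᵢ≡0 ⟩
    0ℚ + ∑ (f ∘ suc)      ≡⟨ ℚ.+-identityˡ _ ⟩
    ∑ (f ∘ suc)           ≤⟨ ∑≤n*max c (f ∘ suc) (f≤c ∘ suc) ⟩
    ι n * c               ∎
    where open ℚ.≤-Reasoning
  ∑≤pred*max {suc n} c f f≤c (suc i) fᵢ≡0 = begin
    f zero + ∑ (f ∘ suc)  ≤⟨ ℚ.+-mono-≤ (f≤c zero) (∑≤pred*max c (f ∘ suc) (f≤c ∘ suc) i fᵢ≡0) ⟩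
    c + ι n * c           ≡⟨ solve 2 (λ n c → c :+ n :* c := (con 1ℚ :+ n) :* c) refl (ι n) c ⟩
    (1ℚ + ι n) * c        ≡⟨ cong (_* c) (ι-+ 1 n) ⟨
    ι (suc n) * c         ∎
    where open ℚ.≤-Reasoning

  -- Traces of squares of natural number matrices

  ιM : ∀ {n} → Matrix ℕ n → Matrix ℚ n
  ιM A i j = ι (A i j)

  tr-sq-mono : ∀ {n} (A B : Matrix ℕ n) → (∀ i j → A i j ℕ.≤ B i j) → tr-sq (ιM A) ≤ tr-sq (ιM B)
  tr-sq-mono A B A≤B = ∑-mono _ _ λ i → ∑-mono _ _ λ j →
    *-mono (0≤ι (A i j)) (0≤ι (B j i)) (ι-mono (A≤B i j)) (ι-mono (A≤B j i))

  0≤tr-sq : ∀ {n} (A : Matrix ℕ n) → 0ℚ ≤ tr-sq (ιM A)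
  0≤tr-sq {n} A = 0≤∑ _ λ i → 0≤∑ _ λ j → 0≤* (0≤ι (A i j)) (0≤ι (A j i))
    where
    0≤∑ : ∀ {m} (f : Vector ℚ m) → (∀ i → 0ℚ ≤ f i) → 0ℚ ≤ ∑ f
    0≤∑ {zero}  f 0≤f = ℚ.≤-refl
    0≤∑ {suc m} f 0≤f = 0≤+ (0≤f zero) (0≤∑ (f ∘ suc) (0≤f ∘ suc))

  tr-sq-bound : ∀ {n} (A : Matrix ℕ (suc n)) Δ → (∀ i → A i i ≡ 0) → (∀ i j → A i j ℕ.≤ Δ) →
    tr-sq (ιM A) ≤ ι (suc n) * (ι n * (ι Δ * ι Δ))
  tr-sq-bound {n} A Δ diag A≤Δ = ∑≤n*max (ι n * (ι Δ * ι Δ)) _ λ i →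
    ∑≤pred*max (ι Δ * ι Δ) _
      (λ j → *-mono (0≤ι (A i j)) (0≤ι Δ) (ι-mono (A≤Δ i j)) (ι-mono (A≤Δ j i)))
      i (cong (λ a → ι a * ι a) (diag i))

  tr≡0 : ∀ {n} (A : Matrix ℕ n) → (∀ i → A i i ≡ 0) → tr (ιM A) ≡ 0ℚ
  tr≡0 {zero}  A diag = refl
  tr≡0 {suc n} A diag = cong₂ _+_ (cong ι (diag zero)) (tr≡0 (λ i j → A (suc i) (suc j)) (diag ∘ suc))

  -- Adjacency and path matrices

  unique⇒length≤ : ∀ {n} {xs ys : List (Fin n)} → Unique xs → xs ⊆ ys → length xs ℕ.≤ length ys
  unique⇒length≤ {xs = []}              _        _     = z≤n
  unique⇒length≤ {xs = x ∷ xs} {ys = ys} (x∉ ∷ uniq) xs⊆ = ℕ.≤-trans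
    (s≤s (unique⇒length≤ uniq λ z∈ → ∈-filter⁺ (λ y → ¬? (x Fin.≟ y)) (xs⊆ (there z∈)) (All.lookup x∉ z∈)))
    (filter-notAll (λ y → ¬? (x Fin.≟ y)) ys (Any.map (λ x≡y x≢y → x≢y x≡y) (xs⊆ (here refl))))

  if-elim : ∀ {A P : Set} (Q : A → Set) (p? : Dec P) {a b} → (P → Q a) → (¬ P → Q b) →
            Q (if ⌊ p? ⌋ then a else b)
  if-elim Q (yes p) qa qb = qa p
  if-elim Q (no ¬p) qa qb = qb ¬p

  module _ {n} (M : Graph n) where
    open Graph M

    degree≤maxDegree : ∀ u → degree M u ℕ.≤ maxDegree M
    degree≤maxDegree u = All.lookup (xs≤max 0 (List.map (degree M) (allFin n))) (∈-map⁺ (degree M)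
        (∈-allFin u))

    degree<order : ∀ u → degree M u ℕ.< n
    degree<order u = subst (degree M u ℕ.<_) (length-tabulate id)
      (filter-notAll (u ~?_) (allFin n) (lose (∈-allFin u) (irrefl refl)))

    adjacencyMatrix-diagonal : ∀ u → adjacencyMatrix M u u ≡ 0
    adjacencyMatrix-diagonal u =
      if-elim (_≡ 0) (u ~? u) (λ u~u → contradiction u~u (irrefl refl)) (λ _ → refl)

    adjacencyMatrix-edge : ∀ {u v} → u ~ v → adjacencyMatrix M u v ≡ 1
    adjacencyMatrix-edge {u} {v} u~v =
      if-elim (_≡ 1) (u ~? v) (λ _ → refl) (λ u≁v → contradiction u~v u≁v)

    pathMatrix-diagonal : ∀ u → pathMatrix M u u ≡ 0
    pathMatrix-diagonal u =
      if-elim (_≡ 0) (u Fin.≟ u) (λ _ → refl) (λ u≢u → contradiction refl u≢u)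

    adjacencyMatrix≤pathMatrix : ∀ u v → adjacencyMatrix M u v ℕ.≤ pathMatrix M u v
    adjacencyMatrix≤pathMatrix u v = if-elim (ℕ._≤ pathMatrix M u v) (u ~? v)
      (λ u~v → if-elim (1 ℕ.≤_) (u Fin.≟ v)
        (λ u≡v → contradiction u~v (irrefl u≡v))
        -- The edge, as the path with empty interior, is a family of size one.
        (λ u≢v → proj₂ (maxDisjointPaths-isGreatest M u v)
          ([] ∷ [] , refl , (u~v ∷ [-] , (u≢v ∷ []) ∷ [] ∷ []) ∷ [] , [] ∷ [])))
      (λ _ → z≤n)

    module _ {u v : Fin n} where

      secondVertex : List (Fin n) → Fin n
      secondVertex []      = v
      secondVertex (x ∷ _) = x

      secondVertex-adjacent : ∀ xs → IsPath M u v xs → u ~ secondVertex xs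
      secondVertex-adjacent []      (u~v ∷ _ , _) = u~v
      secondVertex-adjacent (_ ∷ _) (u~x ∷ _ , _) = u~x

      -- Two paths with interior vertices are separated by disjointness. The edge leads straight to
      -- `v`, which no other path has as an interior vertex, and the condition `xs ≢ ys` prevents
      -- the edge from being counted twice.
      secondVertex-distinct : ∀ xs ys → IsPath M u v xs → IsPath M u v ys →
        VertexDisjoint M xs ys → secondVertex xs ≢ secondVertex ys
      secondVertex-distinct []       []       _ _ (xs≢ys , _) _ = xs≢ys refl
      secondVertex-distinct []       (y ∷ ys) _ (_ , _ ∷ y∉ ∷ _) _ v≡y =
        All.lookup y∉ (∈-++⁺ʳ ys (here refl)) (sym v≡y)
      secondVertex-distinct (x ∷ xs) []       (_ , _ ∷ x∉ ∷ _) _ _ x≡v =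
        All.lookup x∉ (∈-++⁺ʳ xs (here refl)) x≡v
      secondVertex-distinct (x ∷ xs) (y ∷ ys) _ _ (_ , disjoint) x≡y =
        disjoint (here refl , here x≡y)

      secondVertices-unique : ∀ {Ps} → All (IsPath M u v) Ps → AllPairs (VertexDisjoint M) Ps →
        Unique (List.map secondVertex Ps)
      secondVertices-unique []       []       = []
      secondVertices-unique (p ∷ ps) (d ∷ ds) =
        All.map⁺ (All.zipWith (λ (p′ , d′) → secondVertex-distinct _ _ p p′ d′) (ps , d)) ∷
        secondVertices-unique ps ds

      disjointPaths≤degree : ∀ {k} → HasDisjointPaths M u v k → k ℕ.≤ degree M u
      disjointPaths≤degree (Ps , refl , ps , ds) = subst (ℕ._≤ degree M u) (length-map secondVertex Ps)
        (unique⇒length≤ (secondVertices-unique ps ds) λ z∈ → neighbour (∈-map⁻ secondVertex z∈))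
        where
        neighbour : ∀ {z} → _ → z ∈ filter (u ~?_) (allFin n)
        neighbour (xs , xs∈ , refl) =
          ∈-filter⁺ (u ~?_) (∈-allFin _) (secondVertex-adjacent xs (All.lookup ps xs∈))

    pathMatrix≤maxDegree : ∀ u v → pathMatrix M u v ℕ.≤ maxDegree M
    pathMatrix≤maxDegree u v = if-elim (ℕ._≤ maxDegree M) (u Fin.≟ v) (λ _ → z≤n)
      (λ _ → ℕ.≤-trans (disjointPaths≤degree (proj₁ (maxDisjointPaths-isGreatest M u v)))
               (degree≤maxDegree u))

  maxDegree≤ : ∀ {n} (M : Graph (suc n)) → maxDegree M ℕ.≤ n
  maxDegree≤ {n} M = max≤v⁺ z≤n (All.map⁺ (All.universal (λ u →
      ℕ.≤-pred (degree<order M u)) (allFin (suc n))))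

  -- Comparing reals through their squares

  ≃ℝ-sym : ∀ {x y} → x ≃ℝ y → y ≃ℝ x
  ≃ℝ-sym {x} {y} x≃y ε 0<ε = ev-map (λ k → subst (_< ε) (∣p-q∣≡∣q-p∣ (seq x k) (seq y k))) (x≃y ε 0<ε)

  ≃ℝ⇒≤ℝ : ∀ {x y} → x ≃ℝ y → x ≤ℝ y
  ≃ℝ⇒≤ℝ {x} {y} x≃y ε 0<ε = ev-map (λ k close → begin-strict
      seq x k                        ≡⟨ solve 2 (λ a b → a := b :+ (a :- b)) refl (seq x k) (seq y k) ⟩
      seq y k + (seq x k - seq y k)
        <⟨ ℚ.+-monoʳ-< (seq y k) (ℚ.≤-<-trans (p≤∣p∣ (seq x k - seq y k)) close) ⟩
      seq y k + ε                    ∎) (x≃y ε 0<ε)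
    where open ℚ.≤-Reasoning

  ≤ℝ-trans : ∀ {x y z} → x ≤ℝ y → y ≤ℝ z → x ≤ℝ z
  ≤ℝ-trans {x} {y} {z} x≤y y≤z ε 0<ε = ev-zip (λ k x<y y<z → begin-strict
      seq x k                    <⟨ x<y ⟩
      seq y k + ½ * ε            <⟨ ℚ.+-monoˡ-< (½ * ε) y<z ⟩
      seq z k + ½ * ε + ½ * ε    ≡⟨ ℚ.+-assoc (seq z k) (½ * ε) (½ * ε) ⟩
      seq z k + (½ * ε + ½ * ε)  ≡⟨ cong (λ t → seq z k + t) (½+½ ε) ⟩
      seq z k + ε                ∎) (x≤y _ (0<* 0<½ 0<ε)) (y≤z _ (0<* 0<½ 0<ε))
    where open ℚ.≤-Reasoning

  ≤ℝ-antisym : ∀ {x y} → x ≤ℝ y → y ≤ℝ x → x ≃ℝ y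
  ≤ℝ-antisym {x} {y} x≤y y≤x ε 0<ε = ev-zip (λ k x<y y<x → ∣p∣<q
      (subst (seq x k - seq y k <_) (cancel (seq y k) ε) (ℚ.+-monoˡ-< (- seq y k) x<y))
      (subst₂ _<_ (solve 2 (λ a b → b :- a := :- (a :- b)) refl (seq x k) (seq y k)) (cancel (seq x k) ε)
        (ℚ.+-monoˡ-< (- seq x k) y<x)))
    (x≤y ε 0<ε) (y≤x ε 0<ε)
    where
    cancel : ∀ a b → a + b - a ≡ b
    cancel = solve 2 (λ a b → a :+ b :- a := b) refl

  fromℚ*-cong : ∀ q {x y} → x ≃ℝ y → fromℚ q *ℝ x ≃ℝ fromℚ q *ℝ y
  fromℚ*-cong q {x} {y} x≃y = null-cong
    (λ k → solve 3 (λ q a b → q :* (a :- b) := q :* a :- q :* b) refl q (seq x k) (seq y k))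
    (null-scale (λ k → seq x k - seq y k) q x≃y)

  -- The energy estimates have the form of square roots of rationals. Stating them as limiting
  -- bounds on squares avoids forming those roots and leaves a comparison of rationals.
  Square≤ Square≥ : ℝ → ℚ → Set
  Square≤ x c = ∀ ε → 0ℚ < ε → Eventually λ k → seq x k * seq x k < c + ε
  Square≥ x c = ∀ ε → 0ℚ < ε → Eventually λ k → c < seq x k * seq x k + ε

  -- Demanded of every term, so that square roots can be taken index by index; sums of absolute
  -- values meet this exactly.
  NonNegative : ℝ → Set
  NonNegative x = ∀ k → 0ℚ ≤ seq x k

  p<p+ε : ∀ p {ε} → 0ℚ < ε → p < p + ε
  p<p+ε p {ε} 0<ε = subst (_< p + ε) (ℚ.+-identityʳ p) (ℚ.+-monoʳ-< p 0<ε)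

  square≤-fromℚ : ∀ t → Square≤ (fromℚ t) (t * t)
  square≤-fromℚ t ε 0<ε = always λ _ → p<p+ε (t * t) 0<ε

  square≥-fromℚ : ∀ t → Square≥ (fromℚ t) (t * t)
  square≥-fromℚ t ε 0<ε = always λ _ → p<p+ε (t * t) 0<ε

  module _ (q ε : ℚ) (0<ε : 0ℚ < ε) where
    private
      0<K : 0ℚ < 1ℚ + q * q
      0<K = ℚ.+-mono-<-≤ 0<1 (0≤p*p q)

      η = proj₁ (split-off (1ℚ + q * q) ε 0<K 0<ε)
      0<η = proj₁ (proj₂ (split-off (1ℚ + q * q) ε 0<K 0<ε))
      Kη≡ε = proj₂ (proj₂ (split-off (1ℚ + q * q) ε 0<K 0<ε))

    scaled-error : ∃ λ η → 0ℚ < η × (∀ {a b} → a < b + η → q * q * a < q * q * b + ε)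
    scaled-error = η , 0<η , λ {a} {b} a<b+η → begin-strict
      q * q * a                ≤⟨ *-monoˡ (0≤p*p q) (ℚ.<⇒≤ a<b+η) ⟩
      q * q * (b + η)          ≡⟨ ℚ.*-distribˡ-+ (q * q) b η ⟩
      q * q * b + q * q * η
        <⟨ ℚ.+-monoʳ-< (q * q * b) (ℚ.*-monoˡ-<-pos η {{ℚ.positive 0<η}} (p<1+p (q * q))) ⟩
      q * q * b + (1ℚ + q * q) * η ≡⟨ cong (λ t → q * q * b + t) Kη≡ε ⟩
      q * q * b + ε            ∎
      where open ℚ.≤-Reasoning

  square-* : ∀ q x → q * q * (x * x) ≡ q * x * (q * x)
  square-* = solve 2 (λ q x → q :* q :* (x :* x) := q :* x :* (q :* x)) refl

  square≤-scale : ∀ q {x c} → Square≤ x c → Square≤ (fromℚ q *ℝ x) (q * q * c)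
  square≤-scale q {x} {c} x²≤c ε 0<ε =
    let η , 0<η , scale = scaled-error q ε 0<ε
    in ev-map (λ k x²< → subst (_< q * q * c + ε) (square-* q (seq x k))
        (scale {seq x k * seq x k} {c} x²<)) (x²≤c η 0<η)

  square≥-scale : ∀ q {x c} → Square≥ x c → Square≥ (fromℚ q *ℝ x) (q * q * c)
  square≥-scale q {x} {c} c≤x² ε 0<ε =
    let η , 0<η , scale = scaled-error q ε 0<ε
    in ev-map (λ k c< → subst (λ s → q * q * c < s + ε) (square-* q (seq x k))
        (scale {c} {seq x k * seq x k} c<)) (c≤x² η 0<η)

  -- The two errors `η` add up to ε², and y² + ε² ≤ (y + ε)² because the mixed term 2yε is not
  -- negative.
  root-estimate : ∀ {x y c d ε η} → 0ℚ ≤ y → 0ℚ < ε → η + η ≡ ε * ε → c ≤ d →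
    x * x < c + η → d < y * y + η → x < y + ε
  root-estimate {x} {y} {c} {d} {ε} {η} 0≤y 0<ε η+η≡ε² c≤d x²< d< =
    square-reflects-< (ℚ.+-mono-≤ {0ℚ} {y} {0ℚ} {ε} 0≤y (ℚ.<⇒≤ 0<ε)) (begin-strict
      x * x                          <⟨ x²< ⟩
      c + η                          ≤⟨ ℚ.+-monoˡ-≤ η c≤d ⟩
      d + η                          <⟨ ℚ.+-monoˡ-< η d< ⟩
      y * y + η + η                  ≡⟨ ℚ.+-assoc (y * y) η η ⟩
      y * y + (η + η)                ≡⟨ cong (λ t → y * y + t) η+η≡ε² ⟩
      y * y + ε * ε
        ≤⟨ p≤p+q (y * y + ε * ε) (ℚ.+-mono-≤ {0ℚ} {y * ε} {0ℚ} {y * ε} 0≤yε 0≤yε) ⟩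
      y * y + ε * ε + (y * ε + y * ε)
        ≡⟨ solve 2 (λ y ε → y :* y :+ ε :* ε :+ (y :* ε :+ y :* ε) := (y :+ ε) :* (y :+ ε)) refl y ε ⟩
      (y + ε) * (y + ε)              ∎)
    where
    open ℚ.≤-Reasoning
    0≤yε : 0ℚ ≤ y * ε
    0≤yε = 0≤* {y} {ε} 0≤y (ℚ.<⇒≤ 0<ε)

  squares⇒≤ℝ : ∀ {x y c d} → Square≤ x c → Square≥ y d → NonNegative y → c ≤ d → x ≤ℝ y
  squares⇒≤ℝ {x} {y} {c} {d} x²≤c d≤y² 0≤y c≤d ε 0<ε =
    ev-zip (λ k → root-estimate {seq x k} {seq y k} {c} {d} {ε} {½ * (ε * ε)} (0≤y k) 0<ε (½+½ (ε * ε)) c≤d)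
      (x²≤c (½ * (ε * ε)) 0<η) (d≤y² (½ * (ε * ε)) 0<η)
    where
    0<η : 0ℚ < ½ * (ε * ε)
    0<η = 0<* {½} {ε * ε} 0<½ (0<* {ε} {ε} 0<ε 0<ε)

  -- Two-sided bounds for the energy of a matrix with zero diagonal

  module EnergyBounds {n} (A : Matrix ℕ n) (diag : ∀ i → A i i ≡ 0) (μ : Vector ℝ n)
    (eigenvalues : HasEigenvalues (fromℕ-matrix A) μ) where
    private
      -- At a constant rational `x` all entries of the characteristic matrix are constant sequences,
      -- so the determinant stays fixed and only the approximate eigenvalues move with `k`.
      approximate-eigenvalues : ∀ x → Null λ k → detℚ (charMatrix (ιM A) x) - ∏ (λ i → x - seq (μ i) k)
      approximate-eigenvalues x = null-cong
        (λ k → cong₂ _-_ (seq-charpoly (fromℕ-matrix A) (fromℚ x) k) (seq-∏ (λ i → fromℚ x -ℝ μ i) k))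
        (eigenvalues (fromℚ x))

    open Spectrum (ιM A) μ approximate-eigenvalues
    open ℚ.≤-Reasoning

    energy : ℝ
    energy = ∑ℝ λ i → ∣ μ i ∣ℝ

    private
      T = tr-sq (ιM A)

      seq-energy : ∀ k → seq energy k ≡ ∑∣ μ[ k ] ∣
      seq-energy = seq-∑ λ i → ∣ μ i ∣ℝ

      ∑μ→0 : Null λ k → ∑ μ[ k ]
      ∑μ→0 = null-cong
        (λ k → trans (cong (λ t → ∑ μ[ k ] - t) (tr≡0 A diag)) (ℚ.+-identityʳ (∑ μ[ k ])))
        ∑μ→tr

    energy-nonNegative : NonNegative energy
    energy-nonNegative k = subst (0ℚ ≤_) (sym (seq-energy k)) (0≤∑∣∣ μ[ k ])

    energy²≤ : Square≤ energy (ι n * T)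
    energy²≤ ε 0<ε = ev-map (λ k small → begin-strict
        seq energy k * seq energy k        ≡⟨ cong₂ _*_ (seq-energy k) (seq-energy k) ⟩
        ∑∣ μ[ k ] ∣ * ∑∣ μ[ k ] ∣          ≤⟨ ∑∣∣²≤n∑² μ[ k ] ⟩
        ι n * ∑-sq μ[ k ]
          ≡⟨ solve 3 (λ n q t → n :* q := n :* t :+ n :* (q :- t)) refl (ι n) (∑-sq μ[ k ]) T ⟩
        ι n * T + ι n * (∑-sq μ[ k ] - T)
          <⟨ ℚ.+-monoʳ-< (ι n * T) (ℚ.≤-<-trans (p≤∣p∣ (ι n * (∑-sq μ[ k ] - T))) small) ⟩
        ι n * T + ε                        ∎)
      (null-scale (λ k → ∑-sq μ[ k ] - T) (ι n) ∑μ²→tr-sq ε 0<ε)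

    -- At index `k` the error is (∑ μ)² - 2δ. It is null because the sum of the eigenvalues tends to
    -- the trace, which is zero, and `δ` is the error of the second power sum.
    energy²≥ : Square≥ energy (T + T)
    energy²≥ ε 0<ε = ev-map (λ k small → begin-strict
        T + T
          ≡⟨ solve 2 (λ q t → t :+ t := q :+ q :+ (:- (q :- t) :- (q :- t))) refl (∑-sq μ[ k ]) T ⟩
        ∑-sq μ[ k ] + ∑-sq μ[ k ] + (- δ k - δ k)
          ≤⟨ ℚ.+-monoˡ-≤ (- δ k - δ k) (2∑²≤∑∣∣²+∑² μ[ k ]) ⟩
        ∑∣ μ[ k ] ∣ * ∑∣ μ[ k ] ∣ + ∑ μ[ k ] * ∑ μ[ k ] + (- δ k - δ k)
          ≡⟨ solve 3 (λ e s d → e :+ s :+ (:- d :- d) := e :+ (s :+ (:- con 1ℚ :- con 1ℚ) :* d)) refl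
               (∑∣ μ[ k ] ∣ * ∑∣ μ[ k ] ∣) (∑ μ[ k ] * ∑ μ[ k ]) (δ k) ⟩
        ∑∣ μ[ k ] ∣ * ∑∣ μ[ k ] ∣ + (∑ μ[ k ] * ∑ μ[ k ] + (- 1ℚ - 1ℚ) * δ k)
          <⟨ ℚ.+-monoʳ-< (∑∣ μ[ k ] ∣ * ∑∣ μ[ k ] ∣) (ℚ.≤-<-trans
               (p≤∣p∣ (∑ μ[ k ] * ∑ μ[ k ] + (- 1ℚ - 1ℚ) * δ k)) small) ⟩
        ∑∣ μ[ k ] ∣ * ∑∣ μ[ k ] ∣ + ε
          ≡⟨ cong (_+ ε) (cong₂ _*_ (seq-energy k) (seq-energy k)) ⟨
        seq energy k * seq energy k + ε ∎)
      (null-+ (λ k → ∑ μ[ k ] * ∑ μ[ k ]) (λ k → (- 1ℚ - 1ℚ) * δ k)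
        (null-* (λ k → ∑ μ[ k ]) (λ k → ∑ μ[ k ]) ∑μ→0 ∑μ→0)
        (null-scale δ (- 1ℚ - 1ℚ) ∑μ²→tr-sq) ε 0<ε)
      where
      δ : ℕ → ℚ
      δ k = ∑-sq μ[ k ] - T

  -- The numerical comparisons

  half-order*2 : ∀ P T → ½ * P * (½ * P) * (T + T) ≡ ½ * P * (P * T)
  half-order*2 = solve 2 (λ P T → con ½ :* P :* (con ½ :* P) :* (T :+ T) := con ½ :* P :* (P :* T)) refl

  n≤n*n : ∀ n → n ℕ.≤ n ℕ.* n
  n≤n*n zero    = ℕ.z≤n
  n≤n*n (suc n) = ℕ.m≤m*n (suc n) (suc n)

  module _ {n} (M : Graph (suc n)) where
    private
      p Δ : ℕ
      p = suc n
      Δ = maxDegree M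
      T U P N D : ℚ
      T = tr-sq (ιM (adjacencyMatrix M))
      U = tr-sq (ιM (pathMatrix M))
      P = ι p
      N = ι n
      D = ι Δ

      T≤U : T ≤ U
      T≤U = tr-sq-mono (adjacencyMatrix M) (pathMatrix M) (adjacencyMatrix≤pathMatrix M)

      0≤U : 0ℚ ≤ U
      0≤U = 0≤tr-sq (pathMatrix M)

      U≤ : U ≤ P * (N * (D * D))
      U≤ = tr-sq-bound (pathMatrix M) Δ (pathMatrix-diagonal M) (pathMatrix≤maxDegree M)

      -- From two vertices on, p/2 is at least 1. For one vertex the factor p - 1 in `U≤` makes the
      -- left-hand side vanish instead. The auxiliary `k` allows a case split although `n` is a
      -- module parameter.
      P*U≤ : ∀ k → k ≡ n → P * U ≤ ½ * P * (P * U)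
      P*U≤ zero    refl = begin
        P * U                    ≤⟨ *-monoˡ {P} (0≤ι p) U≤ ⟩
        P * (P * (0ℚ * (D * D))) ≡⟨ solve 2 (λ P d → P :* (P :* (con 0ℚ :* d)) := con 0ℚ) refl P (D * D) ⟩
        0ℚ
          ≤⟨ 0≤* {½ * P} {P * U} (0≤* {½} {P} (ℚ.<⇒≤ 0<½) (0≤ι p)) (0≤* {P} {U} (0≤ι p) 0≤U) ⟩
        ½ * P * (P * U)          ∎
        where open ℚ.≤-Reasoning
      P*U≤ (suc k) refl = ≤-scale {½ * P} {P * U}
        (*-monoˡ {½} {ι 2} {P} (ℚ.<⇒≤ 0<½) (ι-mono {2} {p} (ℕ.s≤s (ℕ.s≤s ℕ.z≤n))))
        (0≤* {P} {U} (0≤ι p) 0≤U)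

    p/2 bound : ℚ
    p/2   = ℤ.+ p ℚ./ 2
    bound = ℤ.+ (p ℕ.^ 2 ℕ.* n ℕ.* Δ) ℚ./ 2

    0≤p/2 : 0ℚ ≤ p/2
    0≤p/2 = subst (0ℚ ≤_) (sym (n/2≡½*ι p)) (0≤* {½} {P} (ℚ.<⇒≤ 0<½) (0≤ι p))

    bound≡ : bound ≡ ½ * (P * P * N * D)
    bound≡ = trans (n/2≡½*ι (p ℕ.^ 2 ℕ.* n ℕ.* Δ)) (cong (λ t → ½ * t)
      (trans (ι-* (p ℕ.^ 2 ℕ.* n) Δ) (cong (_* D)
        (trans (ι-* (p ℕ.^ 2) n) (cong (_* N)
          (trans (cong (λ k → ι (p ℕ.* k)) (ℕ.*-identityʳ p)) (ι-* p p)))))))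

    0≤bound : 0ℚ ≤ bound
    0≤bound = subst (0ℚ ≤_) (sym (n/2≡½*ι (p ℕ.^ 2 ℕ.* n ℕ.* Δ)))
      (0≤* {½} {ι (p ℕ.^ 2 ℕ.* n ℕ.* Δ)} (ℚ.<⇒≤ 0<½) (0≤ι (p ℕ.^ 2 ℕ.* n ℕ.* Δ)))

    lower-comparison : P * T ≤ p/2 * p/2 * (U + U)
    lower-comparison = begin
      P * T                        ≤⟨ *-monoˡ {P} {T} {U} (0≤ι p) T≤U ⟩
      P * U                        ≤⟨ P*U≤ n refl ⟩
      ½ * P * (P * U)              ≡⟨ half-order*2 P U ⟨
      ½ * P * (½ * P) * (U + U)    ≡⟨ cong (λ q → q * q * (U + U)) (n/2≡½*ι p) ⟨
      p/2 * p/2 * (U + U)          ∎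
      where open ℚ.≤-Reasoning

    upper-comparison : p/2 * p/2 * (P * U) ≤ bound * bound
    upper-comparison = begin
      p/2 * p/2 * (P * U)
        ≡⟨ cong (λ q → q * q * (P * U)) (n/2≡½*ι p) ⟩
      ½ * P * (½ * P) * (P * U)
        ≤⟨ *-monoˡ {c} (0≤p*p (½ * P)) (*-monoˡ {P} {U} (0≤ι p) U≤) ⟩
      c * (P * (P * (N * (D * D))))
        -- The squared bound contains (p - 1)² where the trace estimate gives p - 1, so one factor
        -- is raised to its square.
        ≤⟨ *-monoˡ {c} (0≤p*p (½ * P)) (*-monoˡ {P} (0≤ι p) (*-monoˡ {P} (0≤ι p)
             (*-monoʳ {D * D} {N} {N * N} (0≤p*p D) (subst (N ≤_) (ι-* n n) (ι-mono {n} {n ℕ.* n}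
                 (n≤n*n n)))))) ⟩
      c * (P * (P * (N * N * (D * D))))
        ≡⟨ solve 3 (λ P N D → con ½ :* P :* (con ½ :* P) :* (P :* (P :* (N :* N :* (D :* D)))) :=
             con ½ :* (P :* P :* N :* D) :* (con ½ :* (P :* P :* N :* D))) refl P N D ⟩
      ½ * (P * P * N * D) * (½ * (P * P * N * D))
        ≡⟨ cong₂ _*_ bound≡ bound≡ ⟨
      bound * bound ∎
      where
      open ℚ.≤-Reasoning
      c = ½ * P * (½ * P)

  -- The equality case

  -- A closed matrix, so that its `tr-sq` evaluates to `ι 2` by computation and only an entrywise
  -- comparison with the adjacency matrix remains.
  single-edge : Matrix ℕ 2
  single-edge zero       (suc zero) = 1
  single-edge (suc zero) zero       = 1
  single-edge _          _          = 0

  K₂-edge : ∀ (M : Graph 2) → M ≅ K 2 → Graph._~_ M zero (suc zero)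
  K₂-edge M (f , edges) = Equivalence.from (edges zero (suc zero)) λ f0≡f1 →
    contradiction
      (trans (sym (Inverse.strictlyInverseʳ f zero))
        (trans (cong (Inverse.from f) f0≡f1) (Inverse.strictlyInverseʳ f (suc zero))))
      λ ()

  K₂-comparison : ∀ {n} (M : Graph (suc n)) → suc n ≡ 2 → M ≅ K 2 →
    bound M * bound M ≤ tr-sq (ιM (adjacencyMatrix M)) + tr-sq (ιM (adjacencyMatrix M))
  K₂-comparison M refl iso = begin
    bound M * bound M  ≤⟨ *-mono {bound M} {ι 2} {bound M} {ι 2} (0≤bound M) (0≤ι 2) bound≤2 bound≤2 ⟩
    ι 2 * ι 2          ≡⟨⟩
    ι 2 + ι 2          ≤⟨ ℚ.+-mono-≤ 2≤T 2≤T ⟩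
    T + T              ∎
    where
    open ℚ.≤-Reasoning
    open Graph M
    T = tr-sq (ιM (adjacencyMatrix M))
    0~1 = K₂-edge M iso
    -- For p = 2 the bound is 4Δ/2, and Δ is at most 1 on two vertices.
    bound≤2 : bound M ≤ ι 2
    bound≤2 = subst (_≤ ι 2) (sym (n/2≡½*ι (4 ℕ.* maxDegree M)))
      (*-monoˡ {½} {ι (4 ℕ.* maxDegree M)} {ι 4} (ℚ.<⇒≤ 0<½)
        (ι-mono {4 ℕ.* maxDegree M} {4} (ℕ.*-monoʳ-≤ 4 (maxDegree≤ M))))
    edge≤ : ∀ i j → single-edge i j ℕ.≤ adjacencyMatrix M i j
    edge≤ zero       zero       = ℕ.z≤n
    edge≤ zero       (suc zero) = ℕ.≤-reflexive (sym (adjacencyMatrix-edge M 0~1))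
    edge≤ (suc zero) zero       = ℕ.≤-reflexive (sym (adjacencyMatrix-edge M (sym~ 0~1)))
    edge≤ (suc zero) (suc zero) = ℕ.z≤n
    2≤T : ι 2 ≤ T
    2≤T = tr-sq-mono single-edge (adjacencyMatrix M) edge≤

-- Transfer of the bounds to the given energies

open import Data.Integer.Base using (+_)
open import Data.Nat.Base using (_*_; _^_; _∸_)
open import Data.Rational.Base using (_/_)

corollary2p5 : ∀ {p : ℕ} (M : Graph p) → Connected M →
    ∀ (E PE : ℝ) → IsEnergy M E → IsPathEnergy M PE →
    (E ≤ℝ fromℚ (+ p / 2) *ℝ PE
    × fromℚ (+ p / 2) *ℝ PE ≤ℝ fromℚ (+ (p ^ 2 * (p ∸ 1) * maxDegree M) / 2))
    × (M ≅ K 2 →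
    E ≃ℝ fromℚ (+ p / 2) *ℝ PE
    × fromℚ (+ p / 2) *ℝ PE ≃ℝ fromℚ (+ (p ^ 2 * (p ∸ 1) * maxDegree M) / 2))
corollary2p5 {suc n} M _ E PE (μ , μ-eigenvalues , E≃) (ρ , ρ-eigenvalues , PE≃) =
  (E≤qPE , qPE≤bound) ,
  -- The single inequality `bound≤E` closes the chain of the two general ones into a cycle, so both
  -- equalities follow by antisymmetry.
  λ iso → let bound≤E = bound≤E-K₂ iso in
    ≤ℝ-antisym {E} {qPE} E≤qPE (≤ℝ-trans {qPE} {fromℚ (bound M)} {E} qPE≤bound bound≤E) ,
    ≤ℝ-antisym {qPE} {fromℚ (bound M)} qPE≤bound (≤ℝ-trans {fromℚ (bound M)} {E} {qPE} bound≤E E≤qPE)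
  where
  module Adjacency = EnergyBounds (adjacencyMatrix M) (adjacencyMatrix-diagonal M) μ μ-eigenvalues
  module Path = EnergyBounds (pathMatrix M) (pathMatrix-diagonal M) ρ ρ-eigenvalues

  q = p/2 M
  qPE qPE′ : ℝ
  qPE  = fromℚ q *ℝ PE
  qPE′ = fromℚ q *ℝ Path.energy

  qPE≃ : qPE ≃ℝ qPE′
  qPE≃ = fromℚ*-cong q {PE} {Path.energy} PE≃

  E≤qPE : E ≤ℝ qPE
  E≤qPE = ≤ℝ-trans {E} {Adjacency.energy} {qPE} (≃ℝ⇒≤ℝ {E} {Adjacency.energy} E≃)
    (≤ℝ-trans {Adjacency.energy} {qPE′} {qPE}
      (squares⇒≤ℝ {Adjacency.energy} {qPE′} Adjacency.energy²≤ (square≥-scale q {Path.energy} Path.energy²≥)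
        (λ k → 0≤* {q} {seq Path.energy k} (0≤p/2 M) (Path.energy-nonNegative k)) (lower-comparison M))
      (≃ℝ⇒≤ℝ {qPE′} {qPE} (≃ℝ-sym {qPE} {qPE′} qPE≃)))

  qPE≤bound : qPE ≤ℝ fromℚ (bound M)
  qPE≤bound = ≤ℝ-trans {qPE} {qPE′} {fromℚ (bound M)} (≃ℝ⇒≤ℝ {qPE} {qPE′} qPE≃)
    (squares⇒≤ℝ {qPE′} {fromℚ (bound M)} (square≤-scale q {Path.energy} Path.energy²≤)
        (square≥-fromℚ (bound M))
      (λ _ → 0≤bound M) (upper-comparison M))

  bound≤E-K₂ : M ≅ K 2 → fromℚ (bound M) ≤ℝ E
  bound≤E-K₂ iso = ≤ℝ-trans {fromℚ (bound M)} {Adjacency.energy} {E}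
    (squares⇒≤ℝ {fromℚ (bound M)} {Adjacency.energy} (square≤-fromℚ (bound M)) Adjacency.energy²≥
      Adjacency.energy-nonNegative (K₂-comparison M (↔⇒≡ (proj₁ iso)) iso))
    (≃ℝ⇒≤ℝ {Adjacency.energy} {E} (≃ℝ-sym {E} {Adjacency.energy} E≃))
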